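{- For every $\varepsilon>0$, there is a (polynomial-time) $(4+\varepsilon)$-approximation algorithm for $2$-Load Coloring.
   Context: Graphs are finite, simple and undirected. For a nonnegative integer $k$ and a graph $G=(V,E)$, write $G\in(2,k)$-LCP if there is a map $\varphi:V\to\{1,2\}$ such that for each $i\in\{1,2\}$ at least $k$ edges have both endvertices colored $i$. $2$-Load Coloring (optimization problem): given a graph $G$, determine the maximum $k$, denoted $k_{opt}$, such that $G\in(2,k)$-LCP. The approximation ratio of an algorithm that outputs a value $k$ with $G\in(2,k)$-LCP is $k_{opt}/k$; thus an $r$-approximation algorithm is a polynomial-time algorithm that, on every input $G$, outputs $k$ with $G\in (2,k)$-LCP and $k_{opt}\le r\cdot k$. Here $\varepsilon$ is fixed, so the running time may depend arbitrarily on $\varepsilon$. -}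

module Defs where

open import Data.Bool.Base using (Bool; true; false)
open import Data.Bool.Properties using (T?)
open import Data.Fin.Base using (Fin; zero; suc; finToFun; funToFin)
open import Data.Fin.Properties using (_<?_; _≟_; all?; any?; finToFun-funToFin)
import Data.Integer.Base as ℤ
open import Data.List.Base using (List; allFin; cartesianProduct; filter; foldr; length; map; replicate)
open import Data.List.Properties using (filter-≐; length-filter)
open import Data.Nat.Base using (ℕ; zero; suc; _+_; _*_; _^_; _≤_; z≤n)
open import Data.Nat.Properties using (_≤?_; ≤-trans; ≤-reflexive; ≤∧≢⇒<; ≤-pred)
open import Data.Product.Base using (∃; ∃-syntax; _×_; _,_; proj₁; proj₂)
open import Data.Rational.Base as ℚ using (ℚ)
open import Data.Vec.Base as Vec using (Vec; lookup; _[_]≔_)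
open import Function.Base using (_∘_)
open import Relation.Binary.PropositionalEquality using (_≡_; _≗_; refl; sym; trans; cong)
open import Relation.Nullary.Decidable using (Dec; yes; no; map′; _×-dec_)

------------------------------------------------------------------------
-- Graphs and load colorings

record Graph : Set where
  field
    order       : ℕ
    adj         : Fin order → Fin order → Bool
    symmetric   : ∀ u v → adj u v ≡ adj v u
    irreflexive : ∀ v → adj v v ≡ false

  Vertex : Set
  Vertex = Fin order

  -- Each undirected edge occurs once, as its increasing pair of ends.
  edges : List (Vertex × Vertex)
  edges = filter (λ (u , v) → (u <? v) ×-dec T? (adj u v))
                 (cartesianProduct (allFin order) (allFin order))

open Graph public using (Vertex; edges)

Coloring : Graph → Set
Coloring G = Vertex G → Fin 2

load : (G : Graph) → Coloring G → Fin 2 → ℕ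
load G φ i = length (filter (λ (u , v) → (φ u ≟ i) ×-dec (φ v ≟ i)) (edges G))

infix 4 _∈[2,_]-LCP

_∈[2,_]-LCP : Graph → ℕ → Set
G ∈[2, k ]-LCP = ∃[ φ ] (∀ i → k ≤ load G φ i)

IsMaximum : (ℕ → Set) → ℕ → Set
IsMaximum P m = P m × (∀ k → P k → k ≤ m)

load-cong : ∀ G {φ ψ : Coloring G} → φ ≗ ψ → load G φ ≗ load G ψ
load-cong G φ≗ψ i = cong length (filter-≐ _ _
  ( (λ {e} (p , q) → trans (sym (φ≗ψ (proj₁ e))) p , trans (sym (φ≗ψ (proj₂ e))) q)
  , (λ {e} (p , q) → trans (φ≗ψ (proj₁ e)) p , trans (φ≗ψ (proj₂ e)) q))
  (edges G))

LCP-bounded : ∀ G k → G ∈[2, k ]-LCP → k ≤ length (edges G)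
LCP-bounded G k (φ , k≤load) = ≤-trans (k≤load zero) (length-filter _ (edges G))

LCP? : ∀ G k → Dec (G ∈[2, k ]-LCP)
LCP? G k = map′
  (λ (c , p) → finToFun c , p)
  (λ (φ , p) → funToFin φ ,
    λ i → ≤-trans (p i) (≤-reflexive (load-cong G (sym ∘ finToFun-funToFin φ) i)))
  (any? λ c → all? λ i → k ≤? load G (finToFun c) i)

optimum-exists : ∀ G → ∃ (IsMaximum (G ∈[2,_]-LCP))
optimum-exists G = search (length (edges G)) (LCP-bounded G)
  where
  search : ∀ b → (∀ k → G ∈[2, k ]-LCP → k ≤ b) → ∃ (IsMaximum (G ∈[2,_]-LCP))
  search b bound with LCP? G b
  search b       bound | yes p = b , p , bound
  search zero    bound | no ¬p = zero , ((λ _ → zero) , λ _ → z≤n) , bound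
  search (suc b) bound | no ¬p = search b λ k q →
    ≤-pred (≤∧≢⇒< (bound k q) λ { refl → ¬p q })

k-opt : Graph → ℕ
k-opt G = proj₁ (optimum-exists G)

------------------------------------------------------------------------
-- Machine model: the WHILE language over binary trees of N. D. Jones
-- (Computability and Complexity from a Programming Perspective, 1997),
-- with Jones's unit-cost running times.  The tree-valued registers are
-- pointers into shared storage, so each operation below is a constant
-- number of pointer operations (there is no structural equality test);
-- polynomial time in this model agrees with polynomial time on Turing
-- machines.

infixr 5 _∙_

data Tree : Set where
  nil : Tree
  _∙_ : Tree → Tree → Tree

head tail : Tree → Tree
head nil     = nil
head (l ∙ r) = l
tail nil     = nil
tail (l ∙ r) = r

size : Tree → ℕ
size nil     = 1
size (l ∙ r) = suc (size l + size r)

data Expression (n : ℕ) : Set where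
  var   : Fin n → Expression n
  nil   : Expression n
  cons  : Expression n → Expression n → Expression n
  hd tl : Expression n → Expression n

infix  6 _:=_
infixr 5 _⨾_

data Command (n : ℕ) : Set where
  _:=_          : Fin n → Expression n → Command n
  _⨾_           : Command n → Command n → Command n
  if_then_else_ : Expression n → Command n → Command n → Command n
  while_loop_   : Expression n → Command n → Command n

Store : ℕ → Set
Store n = Vec Tree n

module _ {n : ℕ} where

  ⟦_⟧ : Expression n → Store n → Tree
  ⟦ var x    ⟧ σ = lookup σ x
  ⟦ nil      ⟧ σ = nil
  ⟦ cons e f ⟧ σ = ⟦ e ⟧ σ ∙ ⟦ f ⟧ σ
  ⟦ hd e     ⟧ σ = head (⟦ e ⟧ σ)
  ⟦ tl e     ⟧ σ = tail (⟦ e ⟧ σ)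

  cost : Expression n → ℕ
  cost (var x)    = 1
  cost nil        = 1
  cost (cons e f) = suc (cost e + cost f)
  cost (hd e)     = suc (cost e)
  cost (tl e)     = suc (cost e)

  infix 4 ⟨_,_⟩⇓_in-time_

  -- As a truth value, nil is false and every other tree is true.
  data ⟨_,_⟩⇓_in-time_ : Command n → Store n → Store n → ℕ → Set where

    assign : ∀ {x e σ} →
      ⟨ x := e , σ ⟩⇓ σ [ x ]≔ ⟦ e ⟧ σ in-time suc (cost e)

    seq : ∀ {C D σ σ′ σ″ s t} →
      ⟨ C , σ ⟩⇓ σ′ in-time s →
      ⟨ D , σ′ ⟩⇓ σ″ in-time t →
      ⟨ C ⨾ D , σ ⟩⇓ σ″ in-time (s + t)

    if-true : ∀ {e C D σ σ′ l r t} →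
      ⟦ e ⟧ σ ≡ l ∙ r →
      ⟨ C , σ ⟩⇓ σ′ in-time t →
      ⟨ if e then C else D , σ ⟩⇓ σ′ in-time (suc (cost e) + t)

    if-false : ∀ {e C D σ σ′ t} →
      ⟦ e ⟧ σ ≡ nil →
      ⟨ D , σ ⟩⇓ σ′ in-time t →
      ⟨ if e then C else D , σ ⟩⇓ σ′ in-time (suc (cost e) + t)

    while-true : ∀ {e C σ σ′ σ″ l r s t} →
      ⟦ e ⟧ σ ≡ l ∙ r →
      ⟨ C , σ ⟩⇓ σ′ in-time s →
      ⟨ while e loop C , σ′ ⟩⇓ σ″ in-time t →
      ⟨ while e loop C , σ ⟩⇓ σ″ in-time (suc (cost e) + s + t)

    while-false : ∀ {e C σ} →
      ⟦ e ⟧ σ ≡ nil →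
      ⟨ while e loop C , σ ⟩⇓ σ in-time suc (cost e)

-- Register 0 holds the input at the start and the output at the end; all
-- other registers start as nil.
record Program : Set where
  constructor program
  field
    {scratch} : ℕ
    body      : Command (suc scratch)

infix 4 _on_outputs_in-time_

_on_outputs_in-time_ : Program → Tree → Tree → ℕ → Set
program {n} C on x outputs y in-time t =
  ∃[ σ ] ⟨ C , x Vec.∷ Vec.replicate n nil ⟩⇓ σ in-time t × lookup σ zero ≡ y

------------------------------------------------------------------------
-- Algorithms taking a graph to a natural number

list : List Tree → Tree
list = foldr _∙_ nil

bit : Bool → Tree
bit false = nil
bit true  = nil ∙ nil

-- The adjacency matrix, as the list of its rows.
encode : Graph → Tree
encode G = list (map (λ u → list (map (λ v → bit (adj u v)) (allFin order))) (allFin order))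
  where open Graph G

unary : ℕ → Tree
unary k = list (replicate k nil)

PolynomialTime : Program → Set
PolynomialTime P = ∃[ c ] ∃[ d ] ∀ G → ∃[ y ] ∃[ t ]
  P on encode G outputs y in-time t × t ≤ c * size (encode G) ^ d + c

Outputs : Program → Graph → ℕ → Set
Outputs P G k = ∃[ t ] P on encode G outputs unary k in-time t

ℕ→ℚ : ℕ → ℚ
ℕ→ℚ n = ℤ.+ n ℚ./ 1

IsApproximationAlgorithm : ℚ → Program → Set
IsApproximationAlgorithm r P =
  PolynomialTime P ×
  (∀ G → ∃[ k ] Outputs P G k × G ∈[2, k ]-LCP × ℕ→ℚ (k-opt G) ℚ.≤ r ℚ.* ℕ→ℚ k)

-- Let m be the number of edges and h v the number of edges avoiding v.  An
-- optimal k is at most m / 2, and at most h v for every v, as one of the two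
-- classes avoids v.  Conversely, if v has degree at least 3k and k ≤ h v, then
-- k edges avoiding v have at most 2k ends, and the remaining vertices contain
-- v together with k of its neighbors.  If no degree reaches 3 ⌈m / 8⌉, and m
-- is large, then signs ±1 of the vertices with both classes containing m / 8
-- edges are found greedily: first for the boundedly many vertices of high
-- degree, keeping the signed sum of the degrees small, then for the others by
-- the method of conditional expectations.  Hence for large m the minimum of
-- ⌈m / 8⌉ and all h v is a 4-approximation.  For small m the optimum is
-- found by trying all colorings of the boundedly many non-isolated vertices.

module Submission where

open import Defs
open import Data.Bool.Base using (Bool; true; false; not; _∧_; _∨_)
import Data.Bool.Properties as Bool
open import Data.Bool.Properties using (T?)
open import Data.Fin.Base using (Fin; zero; suc; inject₁; toℕ)
import Data.Fin.Properties as Fin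
import Data.Integer.Properties as ℤ
open import Data.List.Base
  using (List; []; _∷_; _++_; _ʳ++_; allFin; cartesianProduct; filter; length; map; tabulate; take)
import Data.List.Properties as List
open import Data.List.Membership.Propositional using (_∈_)
open import Data.List.Membership.Propositional.Properties using (∈-allFin)
import Data.List.Membership.DecPropositional as DecMembership
open import Data.List.Relation.Binary.Sublist.Propositional using (⊆-trans)
open import Data.List.Relation.Binary.Sublist.Propositional.Properties using (filter⁺; filter-⊆; take-⊆; length-mono-≤)
open import Data.List.Relation.Unary.All as All using (All)
open import Data.List.Relation.Unary.All.Properties using (all-filter; take⁺)
open import Data.List.Relation.Unary.Any using (here; there)
open import Data.Nat.Base as ℕ using (ℕ; zero; suc; z≤n; s≤s)
import Data.Nat.Properties as ℕ
open import Data.Product.Base using (∃-syntax; _×_; _,_; proj₁; proj₂)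
import Data.Rational.Base as ℚ
import Data.Rational.Properties as ℚ
import Data.Rational.Unnormalised.Properties as ℚᵘ
open import Data.Sum.Base using (_⊎_; inj₁; inj₂)
open import Data.Vec.Base using ([]; _∷_)
open import Function.Base using (_∘_)
open import Relation.Binary.Definitions using (tri<; tri≈; tri>)
open import Relation.Binary.PropositionalEquality
open import Relation.Nullary using (¬_; yes; no; contradiction)
open import Relation.Nullary.Decidable using (Dec; does; _×-dec_; dec-true; dec-false)
open import Relation.Unary using (Decidable)

-- Let `M` = 2m. For signs `s` let `L` be the signed sum of the degrees and `Q` the quadratic form
-- of the adjacency matrix. The classes contain (M ± 2L + Q) / 8 edges, so m / 8 edges in each means
-- M ± 4L + 2Q ≥ 0. As 8 |L| M ≤ 16 L² + M², both inequalities follow from the single one 4 L² - M Q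
-- ≤ M² / 4; this is why one potential serves both classes. Under random signs the expected left
-- side is 4 Σ d², which may exceed the budget when degrees up to D = 3⌈m / 8⌉, about 3M / 16,
-- occur. So the vertices of degree above M / 64 are treated separately: there are at most 64 of
-- them, hence once they are signed - Q is at most 64², while |L| ≤ D. In units of M² / 64 the
-- budget is 16: about 9 go to 4 D², 4 to the squared degrees of the other vertices, and 3 remain
-- for 64² M and for the rounding in ⌈m / 8⌉. This needs M somewhat above 64³ / 3, and 32 · 64²
-- leaves room.

-- Greedy choice of vertex signs.

module SignAssignment where
  open import Data.Integer.Base using (ℤ; +_; -[1+_]; -_; 0ℤ; 1ℤ; -1ℤ; _+_; _*_; _-_; _≤_; _<_; +≤+; -≤+; positive)
  open import Data.Integer.Tactic.RingSolver using (solve-∀)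
  open import Algebra.Properties.Semiring.Sum ℤ.+-*-semiring as Σℤ using () renaming (sum to ∑)

  ≤-by : ∀ {a b} x → 0ℤ ≤ x → b - a ≡ x → a ≤ b
  ≤-by x 0≤x eq = ℤ.0≤i-j⇒j≤i (subst (0ℤ ≤_) (sym eq) 0≤x)

  +-nonneg : ∀ {a b} → 0ℤ ≤ a → 0ℤ ≤ b → 0ℤ ≤ a + b
  +-nonneg = ℤ.+-mono-≤

  *-nonneg : ∀ {a b} → 0ℤ ≤ a → 0ℤ ≤ b → 0ℤ ≤ a * b
  *-nonneg {+ a} {+ b} _ _ = subst (0ℤ ≤_) (ℤ.pos-* a b) (+≤+ z≤n)

  gap : ∀ {a b} → a ≤ b → 0ℤ ≤ b - a
  gap = ℤ.i≤j⇒0≤j-i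

  square-nonneg : ∀ a → 0ℤ ≤ a * a
  square-nonneg (+ a) = *-nonneg {+ a} {+ a} (+≤+ z≤n) (+≤+ z≤n)
  square-nonneg -[1+ a ] = +≤+ z≤n

  ∑-mono : ∀ {n} {f g : Fin n → ℤ} → (∀ i → f i ≤ g i) → ∑ f ≤ ∑ g
  ∑-mono {zero}  h = ℤ.≤-refl
  ∑-mono {suc n} h = ℤ.+-mono-≤ (h zero) (∑-mono (h ∘ suc))

  ∑-nonneg : ∀ {n} {f : Fin n → ℤ} → (∀ i → 0ℤ ≤ f i) → 0ℤ ≤ ∑ f
  ∑-nonneg {zero}  h = ℤ.≤-refl
  ∑-nonneg {suc n} h = +-nonneg (h zero) (∑-nonneg (h ∘ suc))

  -- Kronecker's delta, by recursion on both indices in step with the recursion of `∑`.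
  δ : ∀ {n} → Fin n → Fin n → ℤ
  δ zero    zero    = 1ℤ
  δ zero    (suc _) = 0ℤ
  δ (suc _) zero    = 0ℤ
  δ (suc u) (suc v) = δ u v

  δ-cases : ∀ {n} (u v : Fin n) → (u ≡ v × δ u v ≡ 1ℤ) ⊎ (u ≢ v × δ u v ≡ 0ℤ)
  δ-cases zero    zero    = inj₁ (refl , refl)
  δ-cases zero    (suc _) = inj₂ ((λ ()) , refl)
  δ-cases (suc _) zero    = inj₂ ((λ ()) , refl)
  δ-cases (suc u) (suc v) with δ-cases u v
  ... | inj₁ (u≡v , e) = inj₁ (cong suc u≡v , e)
  ... | inj₂ (u≢v , e) = inj₂ (u≢v ∘ Fin.suc-injective , e)

  dot : ∀ {n} → (Fin n → ℤ) → (Fin n → ℤ) → ℤ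
  dot f g = ∑ (λ v → f v * g v)

  dot-comm : ∀ {n} (f g : Fin n → ℤ) → dot f g ≡ dot g f
  dot-comm f g = Σℤ.sum-cong-≗ (λ v → ℤ.*-comm (f v) (g v))

  dot-+ : ∀ {n} (f g h : Fin n → ℤ) → dot f (λ v → g v + h v) ≡ dot f g + dot f h
  dot-+ f g h = trans (Σℤ.sum-cong-≗ (λ v → ℤ.*-distribˡ-+ (f v) (g v) (h v)))
                      (Σℤ.∑-distrib-+ (λ v → f v * g v) (λ v → f v * h v))

  dot-scale : ∀ {n} k (f g : Fin n → ℤ) → dot f (λ v → k * g v) ≡ k * dot f g
  dot-scale k f g = trans (Σℤ.sum-cong-≗ (λ v → swap (f v) k (g v)))
                          (sym (Σℤ.*-distribˡ-sum k (λ v → f v * g v)))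
    where
    swap : ∀ a b c → a * (b * c) ≡ b * (a * c)
    swap = solve-∀

  dot-δ : ∀ {n} (f : Fin n → ℤ) v → dot f (δ v) ≡ f v
  dot-δ {suc n} f zero = begin
    f zero * 1ℤ + ∑ (λ w → f (suc w) * 0ℤ) ≡⟨ cong₂ _+_ (ℤ.*-identityʳ (f zero)) (Σℤ.sum-cong-≗ (λ w → ℤ.*-zeroʳ (f (suc w)))) ⟩
    f zero + ∑ (λ (_ : Fin n) → 0ℤ)        ≡⟨ cong (_+_ (f zero)) (Σℤ.sum-replicate-zero n) ⟩
    f zero + 0ℤ                            ≡⟨ ℤ.+-identityʳ (f zero) ⟩
    f zero                                 ∎
    where open ≡-Reasoning
  dot-δ {suc n} f (suc v) = begin
    f zero * 0ℤ + dot (f ∘ suc) (δ v) ≡⟨ cong₂ _+_ (ℤ.*-zeroʳ (f zero)) (dot-δ (f ∘ suc) v) ⟩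
    0ℤ + f (suc v)                    ≡⟨ ℤ.+-identityˡ (f (suc v)) ⟩
    f (suc v)                         ∎
    where open ≡-Reasoning

  -- A partial assignment of signs takes the value 0 where it is undefined;
  -- extend s v σ is meant for s v ≡ 0.
  extend : ∀ {n} → (Fin n → ℤ) → Fin n → ℤ → Fin n → ℤ
  extend s v σ w = s w + σ * δ v w

  dot-extend : ∀ {n} (f s : Fin n → ℤ) v σ → dot f (extend s v σ) ≡ dot f s + σ * f v
  dot-extend f s v σ = trans (dot-+ f s (λ w → σ * δ v w))
    (cong (_+_ (dot f s)) (trans (dot-scale σ f (δ v)) (cong (σ *_) (dot-δ f v))))

  IsSign : ℤ → Set
  IsSign σ = σ ≡ 1ℤ ⊎ σ ≡ -1ℤ

  Partial : ∀ {n} → (Fin n → ℤ) → Set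
  Partial s = ∀ v → s v ≡ 0ℤ ⊎ IsSign (s v)

  extend-self : ∀ {n} (s : Fin n → ℤ) v σ → s v ≡ 0ℤ → extend s v σ v ≡ σ
  extend-self s v σ sv≡0 with δ-cases v v
  ... | inj₁ (_ , e) = trans (cong₂ (λ a b → a + σ * b) sv≡0 e) (trans (ℤ.+-identityˡ _) (ℤ.*-identityʳ σ))
  ... | inj₂ (v≢v , _) = contradiction refl v≢v

  extend-other : ∀ {n} (s : Fin n → ℤ) v σ w → v ≢ w → extend s v σ w ≡ s w
  extend-other s v σ w v≢w with δ-cases v w
  ... | inj₁ (v≡w , _) = contradiction v≡w v≢w
  ... | inj₂ (_ , e) = trans (cong (λ b → s w + σ * b) e) (trans (cong (_+_ (s w)) (ℤ.*-zeroʳ σ)) (ℤ.+-identityʳ (s w)))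

  module _ {n : ℕ} (P : (Fin n → ℤ) → Set) (U : Fin n → Bool)
    (step : ∀ s v → P s → U v ≡ true → s v ≡ 0ℤ → ∃[ σ ] IsSign σ × P (extend s v σ))
    (s₀ : Fin n → ℤ) where

    private
      Extends : (Fin n → ℤ) → Set
      Extends s = ∀ v → (U v ≡ true → s v ≡ 0ℤ ⊎ IsSign (s v)) × (U v ≡ false → s v ≡ s₀ v)

      extendAll : ∀ vs → P s₀ → Extends s₀ →
        ∃[ s ] P s × Extends s × (∀ v → v ∈ vs → U v ≡ true → IsSign (s v))
      extendAll []       P₀ E₀ = s₀ , P₀ , E₀ , λ _ ()
      extendAll (v ∷ vs) P₀ E₀ with extendAll vs P₀ E₀
      ... | s , Ps , Es , signs with U v in eq
      ...   | false = s , Ps , Es , λ where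
                w (here refl)  Uw → contradiction (trans (sym Uw) eq) λ ()
                w (there w∈vs) Uw → signs w w∈vs Uw
      ...   | true with proj₁ (Es v) eq
      ...     | inj₂ sv = s , Ps , Es , λ where
                  w (here refl)  _  → sv
                  w (there w∈vs) Uw → signs w w∈vs Uw
      ...     | inj₁ sv≡0 with step s v Ps eq sv≡0
      ...       | σ , σ± , Pe = extend s v σ , Pe , Ee , signs′
        where
        self : IsSign (extend s v σ v)
        self = subst IsSign (sym (extend-self s v σ sv≡0)) σ±
        Ee : Extends (extend s v σ)
        Ee w with v Fin.≟ w
        ... | yes refl = (λ _ → inj₂ self) , λ Uv → contradiction (trans (sym eq) Uv) λ ()
        ... | no v≢w   = subst (λ z → (U w ≡ true → z ≡ 0ℤ ⊎ IsSign z) × (U w ≡ false → z ≡ s₀ w))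
                               (sym (extend-other s v σ w v≢w)) (Es w)
        signs′ : ∀ w → w ∈ v ∷ vs → U w ≡ true → IsSign (extend s v σ w)
        signs′ w w∈ Uw with v Fin.≟ w
        ... | yes refl = self
        signs′ w (here refl)  Uw | no v≢w = contradiction refl v≢w
        signs′ w (there w∈vs) Uw | no v≢w =
          subst IsSign (sym (extend-other s v σ w v≢w)) (signs w w∈vs Uw)

    -- Both rounds of the greedy choice are instances: `P` bounds `L` while the vertices of high
    -- degree are signed, and then bounds `potential` for the others.
    assignSigns : P s₀ → (∀ v → U v ≡ true → s₀ v ≡ 0ℤ) →
      ∃[ s ] P s × (∀ v → U v ≡ true → IsSign (s v)) × (∀ v → U v ≡ false → s v ≡ s₀ v)
    assignSigns P₀ zero₀ with extendAll (allFin n) P₀ (λ v → (λ Uv → inj₁ (zero₀ v Uv)) , λ _ → refl)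
    ... | s , Ps , Es , signs = s , Ps , (λ v → signs v (∈-allFin v)) , λ v → proj₂ (Es v)

  sign-square : ∀ {σ} → IsSign σ → σ * σ ≡ 1ℤ
  sign-square (inj₁ refl) = refl
  sign-square (inj₂ refl) = refl

  opposingSign : ∀ x → ∃[ σ ] IsSign σ × σ * x ≤ 0ℤ
  opposingSign (+ x)    = -1ℤ , inj₂ refl , subst (_≤ 0ℤ) (sym (ℤ.-1*i≡-i (+ x))) (ℤ.neg-mono-≤ {0ℤ} {+ x} (+≤+ z≤n))
  opposingSign -[1+ x ] = 1ℤ , inj₁ refl , subst (_≤ 0ℤ) (sym (ℤ.*-identityˡ -[1+ x ])) -≤+

  -- The squares of a partial signing are the indicator of its domain. They do not see which sign is
  -- chosen, so `N` grows by the same amount for both.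
  square-extend : ∀ {n} (s : Fin n → ℤ) v σ → IsSign σ → s v ≡ 0ℤ → ∀ w →
    extend s v σ w * extend s v σ w ≡ extend (λ w → s w * s w) v 1ℤ w
  square-extend s v σ σ± sv≡0 w with δ-cases v w
  ... | inj₁ (refl , e) rewrite e | sv≡0 = trans (one σ) (sign-square σ±)
    where
    one : ∀ σ → (0ℤ + σ * 1ℤ) * (0ℤ + σ * 1ℤ) ≡ σ * σ
    one = solve-∀
  ... | inj₂ (_ , e) rewrite e = none (s w) σ
    where
    none : ∀ x σ → (x + σ * 0ℤ) * (x + σ * 0ℤ) ≡ x * x + 1ℤ * 0ℤ
    none = solve-∀

  -- If s takes the values ±1 on all vertices, M + Q s ± 2 L s is four times the
  -- (ordered) number of edges inside the class of the sign ±.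
  module Signing {n : ℕ} (a : Fin n → Fin n → ℤ)
    (symmetric : ∀ u v → a u v ≡ a v u) (irreflexive : ∀ v → a v v ≡ 0ℤ)
    (a-cases : ∀ u v → a u v ≡ 0ℤ ⊎ a u v ≡ 1ℤ) where

    d : Fin n → ℤ
    d v = ∑ (a v)

    M : ℤ
    M = ∑ d

    -- For a full signing, `L` compares the degree sums of the two classes, and `Q` is twice the
    -- difference of the numbers of monochromatic and bichromatic edges. `N` is the part of the
    -- variance Σ d² of `L` that the signs chosen so far have removed.
    L Q N : (Fin n → ℤ) → ℤ
    L s = dot d s
    Q s = dot s (λ u → dot (a u) s)
    N s = dot (λ v → d v * d v) (λ v → s v * s v)

    d-nonneg : ∀ v → 0ℤ ≤ d v
    d-nonneg v = ∑-nonneg λ w → case (a-cases v w)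
      where
      case : ∀ {x} → x ≡ 0ℤ ⊎ x ≡ 1ℤ → 0ℤ ≤ x
      case (inj₁ refl) = +≤+ z≤n
      case (inj₂ refl) = +≤+ z≤n

    -- By symmetry row and column `v` contribute equally, hence the factor 2. The term with `σ * σ`
    -- carries the diagonal entry `a v v`, which is 0.
    Q-extend : ∀ s v σ → Q (extend s v σ) ≡ Q s + σ * (+ 2 * dot (a v) s)
    Q-extend s v σ = begin
      dot e (λ u → dot (a u) e)                        ≡⟨ Σℤ.sum-cong-≗ (λ u → cong (_*_ (e u)) (dot-extend (a u) s v σ)) ⟩
      dot e (λ u → g u + σ * a u v)                    ≡⟨ dot-+ e g (λ u → σ * a u v) ⟩
      dot e g + dot e (λ u → σ * a u v)                ≡⟨ cong₂ _+_ (comm-extend g) (trans (dot-scale σ e _) (cong (_*_ σ) (comm-extend (λ u → a u v)))) ⟩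
      (dot s g + σ * g v) + σ * (dot s (λ u → a u v) + σ * a v v)
                                                       ≡⟨ cong₂ (λ x y → (dot s g + σ * g v) + σ * (x + σ * y)) column (irreflexive v) ⟩
      (dot s g + σ * g v) + σ * (g v + σ * 0ℤ)         ≡⟨ collect (dot s g) σ (g v) ⟩
      dot s g + σ * (+ 2 * g v)                        ∎
      where
      open ≡-Reasoning
      e g : Fin n → ℤ
      e = extend s v σ
      g u = dot (a u) s
      comm-extend : ∀ f → dot e f ≡ dot s f + σ * f v
      comm-extend f = trans (dot-comm e f) (trans (dot-extend f s v σ) (cong (λ x → x + σ * f v) (dot-comm f s)))
      column : dot s (λ u → a u v) ≡ g v
      column = trans (dot-comm s _) (Σℤ.sum-cong-≗ (λ u → cong (λ x → x * s u) (symmetric u v)))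
      collect : ∀ q σ x → (q + σ * x) + σ * (x + σ * 0ℤ) ≡ q + σ * (+ 2 * x)
      collect = solve-∀

    N-extend : ∀ s v σ → IsSign σ → s v ≡ 0ℤ → N (extend s v σ) ≡ N s + 1ℤ * (d v * d v)
    N-extend s v σ σ± sv≡0 = trans
      (Σℤ.sum-cong-≗ (λ w → cong (_*_ (d w * d w)) (square-extend s v σ σ± sv≡0 w)))
      (dot-extend (λ v → d v * d v) (λ w → s w * s w) v 1ℤ)

    module _ (D : ℤ) (d≤D : ∀ v → d v ≤ D) where

      Tight : (Fin n → ℤ) → Set
      Tight s = - D ≤ L s × L s ≤ D

      -- A sign opposing `L s` moves the sum towards 0, or past 0 by at most `d v`, which is at most
      -- `D`.
      tighten : ∀ s v → Tight s → ∃[ σ ] IsSign σ × Tight (extend s v σ)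
      tighten s v (lo , hi) with opposingSign (L s)
      ... | σ , σ± , opposes = σ , σ± , subst (λ x → - D ≤ x × x ≤ D) (sym (dot-extend d s v σ)) (go σ± opposes)
        where
        up : ∀ D l d → l + 1ℤ * d - - D ≡ (l - - D) + d
        up = solve-∀
        up′ : ∀ D l d → D - (l + 1ℤ * d) ≡ (D - d) + (0ℤ - 1ℤ * l)
        up′ = solve-∀
        down : ∀ D l d → l + -1ℤ * d - - D ≡ (D - d) + (0ℤ - -1ℤ * l)
        down = solve-∀
        down′ : ∀ D l d → D - (l + -1ℤ * d) ≡ (D - l) + d
        down′ = solve-∀
        go : ∀ {σ} → IsSign σ → σ * L s ≤ 0ℤ → - D ≤ L s + σ * d v × L s + σ * d v ≤ D
        go (inj₁ refl) o =
          ≤-by _ (+-nonneg (gap lo) (d-nonneg v)) (up D (L s) (d v)) ,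
          ≤-by _ (+-nonneg (gap (d≤D v)) (gap o)) (up′ D (L s) (d v))
        go (inj₂ refl) o =
          ≤-by _ (+-nonneg (gap (d≤D v)) (gap o)) (down D (L s) (d v)) ,
          ≤-by _ (+-nonneg (gap hi) (d-nonneg v)) (down′ D (L s) (d v))

    -- Up to a constant, four times the conditional expectation of L² - (M / 4) Q
    -- given the signs chosen so far, the others being random.
    potential : (Fin n → ℤ) → ℤ
    potential s = + 4 * (L s * L s) - M * Q s - + 4 * N s

    -- As `σ * σ ≡ 1`, the square 4 d² added by the term in `L` cancels the growth of `4 * N`. The
    -- remaining change is linear in `σ`, so one of the two signs does not increase the potential.
    decreasePotential : ∀ s v → s v ≡ 0ℤ → ∃[ σ ] IsSign σ × potential (extend s v σ) ≤ potential s
    decreasePotential s v sv≡0 with opposingSign (+ 4 * (d v * L s) - M * dot (a v) s)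
    ... | σ , σ± , opposes = σ , σ± , ≤-by _
        (+-nonneg (+-nonneg (gap opposes) (gap opposes)) (ℤ.≤-reflexive (sym vanishes)))
        (trans (cong (_-_ (potential s)) expand) (collect (L s) (Q s) (N s) (d v) M (dot (a v) s) σ))
      where
      expand : potential (extend s v σ) ≡
        + 4 * ((L s + σ * d v) * (L s + σ * d v)) - M * (Q s + σ * (+ 2 * dot (a v) s)) - + 4 * (N s + 1ℤ * (d v * d v))
      expand = cong₂ _-_ (cong₂ _-_ (cong (λ x → + 4 * (x * x)) (dot-extend d s v σ)) (cong (_*_ M) (Q-extend s v σ)))
                         (cong (_*_ (+ 4)) (N-extend s v σ σ± sv≡0))
      vanishes : + 4 * (d v * d v) * (1ℤ - σ * σ) ≡ 0ℤ
      vanishes = trans (cong (λ x → + 4 * (d v * d v) * (1ℤ - x)) (sign-square σ±)) (ℤ.*-zeroʳ (+ 4 * (d v * d v)))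
      collect : ∀ l q m d M c σ →
        (+ 4 * (l * l) - M * q - + 4 * m) -
          (+ 4 * ((l + σ * d) * (l + σ * d)) - M * (q + σ * (+ 2 * c)) - + 4 * (m + 1ℤ * (d * d)))
        ≡ (0ℤ - σ * (+ 4 * (d * l) - M * c)) + (0ℤ - σ * (+ 4 * (d * l) - M * c)) + + 4 * (d * d) * (1ℤ - σ * σ)
      collect = solve-∀

    ∑-*ˡ-mono : ∀ {f g : Fin n → ℤ} k l → (∀ v → k * f v ≤ l * g v) → k * ∑ f ≤ l * ∑ g
    ∑-*ˡ-mono {f} {g} k l h = subst₂ _≤_ (sym (Σℤ.*-distribˡ-sum k f)) (sym (Σℤ.*-distribˡ-sum l g)) (∑-mono h)

    -- The sum of squares is the number of signed vertices. Only pairs of signed vertices contribute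
    -- to `Q s`, each at least -1.
    Q-lower : ∀ s → Partial s → - (∑ (λ v → s v * s v) * ∑ (λ v → s v * s v)) ≤ Q s
    Q-lower s s± = subst (_≤ Q s) product (∑-mono λ u → subst₂ _≤_
        (sym (Σℤ.*-distribˡ-sum (- (s u * s u)) (λ w → s w * s w)))
        (sym (Σℤ.*-distribˡ-sum (s u) (λ w → a u w * s w)))
        (∑-mono λ w → term (s± u) (a-cases u w) (s± w)))
      where
      product : ∑ (λ u → - (s u * s u) * ∑ (λ w → s w * s w)) ≡ - (∑ (λ v → s v * s v) * ∑ (λ v → s v * s v))
      product = trans (Σℤ.sum-cong-≗ (λ u → negate (s u * s u) (∑ (λ w → s w * s w))))
        (trans (sym (Σℤ.*-distribˡ-sum (- ∑ (λ w → s w * s w)) (λ u → s u * s u)))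
               (sym (ℤ.neg-distribˡ-* (∑ (λ v → s v * s v)) (∑ (λ v → s v * s v)))))
        where
        negate : ∀ x y → - x * y ≡ - y * x
        negate = solve-∀
      term : ∀ {x b y} → x ≡ 0ℤ ⊎ IsSign x → b ≡ 0ℤ ⊎ b ≡ 1ℤ → y ≡ 0ℤ ⊎ IsSign y →
        - (x * x) * (y * y) ≤ x * (b * y)
      term (inj₁ refl) (inj₁ refl) (inj₁ refl) = ℤ.≤-refl
      term (inj₁ refl) (inj₁ refl) (inj₂ (inj₁ refl)) = ℤ.≤-refl
      term (inj₁ refl) (inj₁ refl) (inj₂ (inj₂ refl)) = ℤ.≤-refl
      term (inj₁ refl) (inj₂ refl) (inj₁ refl) = ℤ.≤-refl
      term (inj₁ refl) (inj₂ refl) (inj₂ (inj₁ refl)) = ℤ.≤-refl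
      term (inj₁ refl) (inj₂ refl) (inj₂ (inj₂ refl)) = ℤ.≤-refl
      term (inj₂ (inj₁ refl)) (inj₁ refl) (inj₁ refl) = ℤ.≤-refl
      term (inj₂ (inj₁ refl)) (inj₁ refl) (inj₂ (inj₁ refl)) = -≤+
      term (inj₂ (inj₁ refl)) (inj₁ refl) (inj₂ (inj₂ refl)) = -≤+
      term (inj₂ (inj₁ refl)) (inj₂ refl) (inj₁ refl) = ℤ.≤-refl
      term (inj₂ (inj₁ refl)) (inj₂ refl) (inj₂ (inj₁ refl)) = -≤+
      term (inj₂ (inj₁ refl)) (inj₂ refl) (inj₂ (inj₂ refl)) = ℤ.≤-refl
      term (inj₂ (inj₂ refl)) (inj₁ refl) (inj₁ refl) = ℤ.≤-refl
      term (inj₂ (inj₂ refl)) (inj₁ refl) (inj₂ (inj₁ refl)) = -≤+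
      term (inj₂ (inj₂ refl)) (inj₁ refl) (inj₂ (inj₂ refl)) = -≤+
      term (inj₂ (inj₂ refl)) (inj₂ refl) (inj₁ refl) = ℤ.≤-refl
      term (inj₂ (inj₂ refl)) (inj₂ refl) (inj₂ (inj₁ refl)) = ℤ.≤-refl
      term (inj₂ (inj₂ refl)) (inj₂ refl) (inj₂ (inj₂ refl)) = -≤+

    -- A vertex has high degree if its degree exceeds M / κ.
    module _ (κ : ℤ) (κ≡64 : κ ≡ + 64) where

      private
        0≤κ : 0ℤ ≤ κ
        0≤κ = subst (0ℤ ≤_) (sym κ≡64) (+≤+ z≤n)

      highDegree : Fin n → Bool
      highDegree v = does (M ℤ.<? κ * d v)

      high : ∀ v → highDegree v ≡ true → M ≤ κ * d v
      high v e with M ℤ.<? κ * d v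
      high v e  | yes p = ℤ.<⇒≤ p
      high v () | no _

      low : ∀ v → highDegree v ≡ false → κ * d v ≤ M
      low v e with M ℤ.<? κ * d v
      low v () | yes _
      low v e  | no ¬p = ℤ.≮⇒≥ ¬p

      record Signs (D : ℤ) : Set where
        field
          s₀ s       : Fin n → ℤ
          tight      : - D ≤ L s₀ × L s₀ ≤ D
          signed₀    : ∀ v → highDegree v ≡ true → IsSign (s₀ v)
          unsigned₀  : ∀ v → highDegree v ≡ false → s₀ v ≡ 0ℤ
          below      : potential s ≤ potential s₀
          signed     : ∀ v → not (highDegree v) ≡ true → IsSign (s v)
          kept       : ∀ v → not (highDegree v) ≡ false → s v ≡ s₀ v

      -- The few vertices of high degree are signed first, keeping only L small:
      -- they contribute at most a constant to - Q.  The potential takes care of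
      -- the vertices of low degree.
      assignAllSigns : ∀ D → (∀ v → d v ≤ D) → 0ℤ ≤ D → Signs D
      assignAllSigns D d≤D 0≤D = extendToLow
        (assignSigns (Tight D d≤D) highDegree (λ s v tight _ _ → tighten D d≤D s v tight) (λ _ → 0ℤ)
          (subst (λ x → - D ≤ x × x ≤ D) (sym L0≡0) (ℤ.neg-mono-≤ 0≤D , 0≤D)) (λ _ _ → refl))
        where
        L0≡0 : L (λ _ → 0ℤ) ≡ 0ℤ
        L0≡0 = trans (Σℤ.sum-cong-≗ (λ v → ℤ.*-zeroʳ (d v))) (Σℤ.sum-replicate-zero n)
        not-true : ∀ {b} → not b ≡ true → b ≡ false
        not-true {false} _ = refl
        extendToLow : ∃[ s₀ ] Tight D d≤D s₀ × (∀ v → highDegree v ≡ true → IsSign (s₀ v))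
                        × (∀ v → highDegree v ≡ false → s₀ v ≡ 0ℤ) → Signs D
        extendToLow (s₀ , tight , signed₀ , unsigned₀) =
          let s , below , signed , kept = assignSigns (λ s → potential s ≤ potential s₀) (not ∘ highDegree)
                (λ s v below _ sv≡0 → let σ , σ± , le = decreasePotential s v sv≡0 in σ , σ± , ℤ.≤-trans le below)
                s₀ ℤ.≤-refl (λ v isLow → unsigned₀ v (not-true isLow))
          in record { s₀ = s₀ ; s = s ; tight = tight ; signed₀ = signed₀ ; unsigned₀ = unsigned₀
                    ; below = below ; signed = signed ; kept = kept }

      module Bounds (D : ℤ) (0<M : 0ℤ < M) (S : Signs D) where
        open Signs S

        onHigh : ∀ v → highDegree v ≡ true → s v ≡ s₀ v
        onHigh v isHigh = kept v (cong not isHigh)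

        signs : ∀ v → IsSign (s v)
        signs v with highDegree v in eq
        ... | true  = subst IsSign (sym (onHigh v eq)) (signed₀ v eq)
        ... | false = signed v (cong not eq)

        partial₀ : Partial s₀
        partial₀ v with highDegree v in eq
        ... | true  = inj₂ (signed₀ v eq)
        ... | false = inj₁ (unsigned₀ v eq)

        t : ℤ
        t = ∑ (λ v → s₀ v * s₀ v)

        -- `t` is the number of vertices of high degree. Each takes at least `M / κ` of the degree
        -- sum `M`; the factor `M` avoids the division.
        few-high : M * t ≤ κ * M
        few-high = ∑-*ˡ-mono M κ term
          where
          term : ∀ v → M * (s₀ v * s₀ v) ≤ κ * d v
          term v with highDegree v in eq
          ... | true  = subst (_≤ κ * d v) (sym (trans (cong (_*_ M) (sign-square (signed₀ v eq))) (ℤ.*-identityʳ M))) (high v eq)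
          ... | false = subst (_≤ κ * d v)
                          (sym (trans (cong (λ x → M * (x * x)) (unsigned₀ v eq)) (ℤ.*-zeroʳ M)))
                          (*-nonneg {κ} 0≤κ (d-nonneg v))

        -- A vertex signed in the second round has `κ * d v ≤ M`, hence κ d² ≤ M d, and the degrees
        -- sum to `M`.
        low-squares : κ * N s ≤ κ * N s₀ + M * M
        low-squares = subst₂ _≤_ (sym (Σℤ.*-distribˡ-sum κ (square s)))
          (trans (Σℤ.∑-distrib-+ (λ v → κ * square s₀ v) (λ v → M * d v))
                 (sym (cong₂ _+_ (Σℤ.*-distribˡ-sum κ (square s₀)) (Σℤ.*-distribˡ-sum M d))))
          (∑-mono term)
          where
          square : (Fin n → ℤ) → Fin n → ℤ
          square s v = d v * d v * (s v * s v)
          same : ∀ κ x M d → κ * x + M * d - κ * x ≡ M * d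
          same = solve-∀
          differ : ∀ κ M x → κ * (x * x * (0ℤ * 0ℤ)) + M * x - κ * (x * x * 1ℤ) ≡ (M - κ * x) * x
          differ = solve-∀
          term : ∀ v → κ * square s v ≤ κ * square s₀ v + M * d v
          term v with highDegree v in eq
          ... | true rewrite onHigh v eq =
            ≤-by (M * d v) (*-nonneg (ℤ.<⇒≤ 0<M) (d-nonneg v)) (same κ (square s₀ v) M (d v))
          ... | false rewrite sign-square (signed v (cong not eq)) | unsigned₀ v eq =
            ≤-by ((M - κ * d v) * d v) (*-nonneg (gap (low v eq)) (d-nonneg v)) (differ κ M (d v))

        L₀-small : 0ℤ ≤ D * D - L s₀ * L s₀
        L₀-small = subst (0ℤ ≤_) (difference D (L s₀)) (*-nonneg (gap (proj₁ tight)) (gap (proj₂ tight)))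
          where
          difference : ∀ D l → (l - - D) * (D - l) ≡ D * D - l * l
          difference = solve-∀

        -- From t ≤ κ follows Q ≥ - t² ≥ - κ². The three products express this with the factor `M`
        -- still in place, as only `few-high` is at hand.
        Q₀-small : 0ℤ ≤ M * Q s₀ + κ * κ * M
        Q₀-small = subst (0ℤ ≤_) (collect κ M (Q s₀) t)
          (+-nonneg (+-nonneg (*-nonneg (ℤ.<⇒≤ 0<M) (gap (Q-lower s₀ partial₀)))
                              (*-nonneg (∑-nonneg (λ v → square-nonneg (s₀ v))) (gap few-high)))
                    (*-nonneg {κ} 0≤κ (gap few-high)))
          where
          collect : ∀ κ M q t → M * (q - - (t * t)) + t * (κ * M - M * t) + κ * (κ * M - M * t) ≡ M * q + κ * κ * M
          collect = solve-∀

        -- The product of `16 * M` with the claimed quantity is a combination of six nonnegative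
        -- terms: the decrease of the potential, the square of `4 * L s + τ * M`, which trades the
        -- linear term for L², the bound on the new part of `N`, the bounds on `L` and `Q` after the
        -- first round, and the slack in the hypothesis.
        final : + 64 * (D * D) + + 16 * (κ * κ * M) ≤ + 3 * (M * M) → ∀ τ → IsSign τ → 0ℤ ≤ M + + 4 * (τ * L s) + + 2 * Q s
        final large τ τ± = ℤ.*-cancelˡ-≤-pos 0ℤ _ (+ 16 * M) ⦃ positive (ℤ.*-monoˡ-<-pos (+ 16) 0<M) ⦄
          (subst (_≤ + 16 * M * (M + + 4 * (τ * L s) + + 2 * Q s)) (sym (ℤ.*-zeroʳ (+ 16 * M)))
            (combine (gap below) (square-nonneg (+ 4 * L s + τ * M)) (gap (subst (λ k → k * N s ≤ k * N s₀ + M * M) κ≡64 low-squares)) L₀-small Q₀-small (gap large)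
              (collect κ τ (L s) (Q s) (N s) (L s₀) (Q s₀) (N s₀) M D τ±)))
          where
          combine : ∀ {a b c d e f y} → 0ℤ ≤ a → 0ℤ ≤ b → 0ℤ ≤ c → 0ℤ ≤ d → 0ℤ ≤ e → 0ℤ ≤ f →
            + 32 * a + + 8 * b + + 2 * c + + 128 * d + + 32 * e + + 2 * f ≡ y → 0ℤ ≤ y
          combine {a} {b} {c} {d} {e} {f} pa pb pc pd pe pf eq = subst (0ℤ ≤_) eq
            (+-nonneg {+ 32 * a + + 8 * b + + 2 * c + + 128 * d + + 32 * e} {+ 2 * f}
              (+-nonneg {+ 32 * a + + 8 * b + + 2 * c + + 128 * d} {+ 32 * e}
                (+-nonneg {+ 32 * a + + 8 * b + + 2 * c} {+ 128 * d}
                  (+-nonneg {+ 32 * a + + 8 * b} {+ 2 * c}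
                    (+-nonneg {+ 32 * a} {+ 8 * b} (*-nonneg {+ 32} {a} (+≤+ z≤n) pa) (*-nonneg {+ 8} {b} (+≤+ z≤n) pb))
                    (*-nonneg {+ 2} {c} (+≤+ z≤n) pc))
                  (*-nonneg {+ 128} {d} (+≤+ z≤n) pd))
                (*-nonneg {+ 32} {e} (+≤+ z≤n) pe))
              (*-nonneg {+ 2} {f} (+≤+ z≤n) pf))
          plus : ∀ κ l q m l₀ q₀ m₀ M D →
            + 32 * ((+ 4 * (l₀ * l₀) - M * q₀ - + 4 * m₀) - (+ 4 * (l * l) - M * q - + 4 * m))
            + + 8 * ((+ 4 * l + 1ℤ * M) * (+ 4 * l + 1ℤ * M))
            + + 2 * (+ 64 * m₀ + M * M - + 64 * m)
            + + 128 * (D * D - l₀ * l₀)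
            + + 32 * (M * q₀ + κ * κ * M)
            + + 2 * (+ 3 * (M * M) - (+ 64 * (D * D) + + 16 * (κ * κ * M)))
            ≡ + 16 * M * (M + + 4 * (1ℤ * l) + + 2 * q)
          plus = solve-∀
          minus : ∀ κ l q m l₀ q₀ m₀ M D →
            + 32 * ((+ 4 * (l₀ * l₀) - M * q₀ - + 4 * m₀) - (+ 4 * (l * l) - M * q - + 4 * m))
            + + 8 * ((+ 4 * l + -1ℤ * M) * (+ 4 * l + -1ℤ * M))
            + + 2 * (+ 64 * m₀ + M * M - + 64 * m)
            + + 128 * (D * D - l₀ * l₀)
            + + 32 * (M * q₀ + κ * κ * M)
            + + 2 * (+ 3 * (M * M) - (+ 64 * (D * D) + + 16 * (κ * κ * M)))
            ≡ + 16 * M * (M + + 4 * (-1ℤ * l) + + 2 * q)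
          minus = solve-∀
          collect : ∀ κ τ l q m l₀ q₀ m₀ M D → IsSign τ →
            + 32 * ((+ 4 * (l₀ * l₀) - M * q₀ - + 4 * m₀) - (+ 4 * (l * l) - M * q - + 4 * m))
            + + 8 * ((+ 4 * l + τ * M) * (+ 4 * l + τ * M))
            + + 2 * (+ 64 * m₀ + M * M - + 64 * m)
            + + 128 * (D * D - l₀ * l₀)
            + + 32 * (M * q₀ + κ * κ * M)
            + + 2 * (+ 3 * (M * M) - (+ 64 * (D * D) + + 16 * (κ * κ * M)))
            ≡ + 16 * M * (M + + 4 * (τ * l) + + 2 * q)
          collect κ _ l q m l₀ q₀ m₀ M D (inj₁ refl) = plus κ l q m l₀ q₀ m₀ M D
          collect κ _ l q m l₀ q₀ m₀ M D (inj₂ refl) = minus κ l q m l₀ q₀ m₀ M D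

-- Counting edges inside vertex sets, and the bounds on the optimum.

module EdgeCounting where
  open import Data.Nat.Base using (_+_; _*_; _≤_)
  open import Data.Nat.Tactic.RingSolver using (solve-∀)
  open import Algebra.Properties.Semiring.Sum ℕ.+-*-semiring as Σℕ using () renaming (sum to ∑)

  ∑-mono-≤ : ∀ {n} {f g : Fin n → ℕ} → (∀ i → f i ≤ g i) → ∑ f ≤ ∑ g
  ∑-mono-≤ {zero}  h = z≤n
  ∑-mono-≤ {suc n} h = ℕ.+-mono-≤ (h zero) (∑-mono-≤ (h ∘ suc))

  term≤∑ : ∀ {n} (f : Fin n → ℕ) i → f i ≤ ∑ f
  term≤∑ f zero    = ℕ.m≤m+n _ _
  term≤∑ f (suc i) = ℕ.≤-trans (term≤∑ (f ∘ suc) i) (ℕ.m≤n+m _ _)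

  ind : Bool → ℕ
  ind true  = 1
  ind false = 0

  ind-mono : ∀ {a b} → (a ≡ true → b ≡ true) → ind a ≤ ind b
  ind-mono {false} h = z≤n
  ind-mono {true}  h rewrite h refl = ℕ.≤-refl

  ∧-true : ∀ {a b} → a ∧ b ≡ true → a ≡ true × b ≡ true
  ∧-true {true} {true} _ = refl , refl

  length-filter-tabulate : ∀ {A : Set} {P : A → Set} (P? : Decidable P) {n} (f : Fin n → A) →
    length (filter P? (tabulate f)) ≡ ∑ (λ i → ind (does (P? (f i))))
  length-filter-tabulate P? {zero}  f = refl
  length-filter-tabulate P? {suc n} f with does (P? (f zero))
  ... | true  = cong suc (length-filter-tabulate P? (f ∘ suc))
  ... | false = length-filter-tabulate P? (f ∘ suc)

  length-filter-cartesianProduct : ∀ {A B : Set} {P : A × B → Set} (P? : Decidable P)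
    {m n} (f : Fin m → A) (g : Fin n → B) →
    length (filter P? (cartesianProduct (tabulate f) (tabulate g))) ≡
    ∑ (λ i → ∑ (λ j → ind (does (P? (f i , g j)))))
  length-filter-cartesianProduct P? {zero}  f g = refl
  length-filter-cartesianProduct P? {suc m} f g = begin
    length (filter P? (map (f zero ,_) (tabulate g) ++ rest))
      ≡⟨ cong length (List.filter-++ P? (map (f zero ,_) (tabulate g)) rest) ⟩
    length (filter P? (map (f zero ,_) (tabulate g)) ++ filter P? rest)
      ≡⟨ List.length-++ (filter P? (map (f zero ,_) (tabulate g))) ⟩
    length (filter P? (map (f zero ,_) (tabulate g))) + length (filter P? rest)
      ≡⟨ cong₂ _+_ (trans (cong (length ∘ filter P?) (List.map-tabulate g (f zero ,_)))
                          (length-filter-tabulate P? (λ j → f zero , g j)))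
                   (length-filter-cartesianProduct P? (f ∘ suc) g) ⟩
    ∑ (λ i → ∑ (λ j → ind (does (P? (f i , g j))))) ∎
    where
    open ≡-Reasoning
    rest = cartesianProduct (tabulate (f ∘ suc)) (tabulate g)

  length-filter-filter : ∀ {A : Set} {P Q : A → Set} (P? : Decidable P) (Q? : Decidable Q) xs →
    length (filter P? (filter Q? xs)) ≡ length (filter (λ x → Q? x ×-dec P? x) xs)
  length-filter-filter P? Q? []       = refl
  length-filter-filter P? Q? (x ∷ xs) with does (Q? x)
  ... | false = length-filter-filter P? Q? xs
  ... | true  with does (P? x)
  ...   | true  = cong suc (length-filter-filter P? Q? xs)
  ...   | false = length-filter-filter P? Q? xs

  degree : ∀ {m n} → (Fin m → Fin n → Bool) → Fin m → ℕ
  degree A u = ∑ (λ w → ind (A u w))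

  -- Counts ordered pairs. Rows and columns have separate index types and sets because the machine
  -- will count row by row, with a matrix that loses its first row at each step.
  within : ∀ {m n} → (Fin m → Fin n → Bool) → (Fin m → Bool) → (Fin n → Bool) → ℕ
  within A χ ρ = ∑ (λ u → ∑ (λ w → ind (A u w ∧ (χ u ∧ ρ w))))

  within-cong : ∀ {m n} (A : Fin m → Fin n → Bool) {χ χ′ ρ ρ′} → χ ≗ χ′ → ρ ≗ ρ′ → within A χ ρ ≡ within A χ′ ρ′
  within-cong A p q = Σℕ.sum-cong-≗ λ u → Σℕ.sum-cong-≗ λ w → cong₂ (λ x y → ind (A u w ∧ (x ∧ y))) (p u) (q w)

  ∧-mono : ∀ a {b c} → (b ≡ true → c ≡ true) → a ∧ b ≡ true → a ∧ c ≡ true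
  ∧-mono true h = h

  within-mono : ∀ {n} {A : Fin n → Fin n → Bool} {χ ρ} → (∀ v → χ v ≡ true → ρ v ≡ true) → within A χ χ ≤ within A ρ ρ
  within-mono {A = A} {χ} {ρ} h = ∑-mono-≤ λ u → ∑-mono-≤ λ w → ind-mono
    (∧-mono (A u w) λ both → let p , q = ∧-true {χ u} both in cong₂ _∧_ (h u p) (h w q))

  all : ∀ {n} → Fin n → Bool
  all _ = true

  -- Twice the number of edges of G with both ends in χ.
  twiceEdges : (G : Graph) → (Vertex G → Bool) → ℕ
  twiceEdges G χ = within (Graph.adj G) χ χ

  class : ∀ {n} → (Fin n → Fin 2) → Fin 2 → Fin n → Bool
  class φ i v = does (φ v Fin.≟ i)

  module _ (G : Graph) where
    open Graph G using (order; adj; symmetric; irreflexive)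

    -- `edges` holds increasing pairs only. Adding the transposed sum restores the decreasing ones,
    -- and the diagonal is empty by irreflexivity.
    2*load : ∀ φ i → 2 * load G φ i ≡ twiceEdges G (class φ i)
    2*load φ i = begin
      2 * load G φ i                          ≡⟨ double (load G φ i) ⟩
      load G φ i + load G φ i                 ≡⟨ cong₂ _+_ count count ⟩
      ∑ (λ u → ∑ (e u)) + ∑ (λ u → ∑ (e u))   ≡⟨ cong (∑ (λ u → ∑ (e u)) +_) (Σℕ.∑-comm e) ⟩
      ∑ (λ u → ∑ (e u)) + ∑ (λ u → ∑ (λ w → e w u)) ≡⟨ sym (Σℕ.∑-distrib-+ (λ u → ∑ (e u)) (λ u → ∑ (λ w → e w u))) ⟩
      ∑ (λ u → ∑ (e u) + ∑ (λ w → e w u))     ≡⟨ Σℕ.sum-cong-≗ (λ u → sym (Σℕ.∑-distrib-+ (e u) (λ w → e w u))) ⟩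
      ∑ (λ u → ∑ (λ w → e u w + e w u))       ≡⟨ Σℕ.sum-cong-≗ (λ u → Σℕ.sum-cong-≗ (unordered u)) ⟩
      twiceEdges G (class φ i)                ∎
      where
      open ≡-Reasoning
      double : ∀ x → 2 * x ≡ x + x
      double = solve-∀
      χ : Vertex G → Bool
      χ = class φ i
      e : Vertex G → Vertex G → ℕ
      e u w = ind ((does (u Fin.<? w) ∧ adj u w) ∧ (χ u ∧ χ w))
      count : load G φ i ≡ ∑ (λ u → ∑ (e u))
      count = trans
        (length-filter-filter (λ (u , w) → (φ u Fin.≟ i) ×-dec (φ w Fin.≟ i))
                              (λ (u , w) → (u Fin.<? w) ×-dec T? (adj u w))
                              (cartesianProduct (allFin order) (allFin order)))
        (length-filter-cartesianProduct
          (λ (u , w) → ((u Fin.<? w) ×-dec T? (adj u w)) ×-dec ((φ u Fin.≟ i) ×-dec (φ w Fin.≟ i)))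
          (λ u → u) (λ w → w))
      unordered : ∀ u w → e u w + e w u ≡ ind (adj u w ∧ (χ u ∧ χ w))
      unordered u w with Fin.<-cmp u w
      ... | tri< u<w _ u≯w rewrite dec-true (u Fin.<? w) u<w | dec-false (w Fin.<? u) u≯w = ℕ.+-identityʳ _
      ... | tri≈ u≮w refl _ rewrite dec-false (u Fin.<? u) u≮w | irreflexive u = refl
      ... | tri> u≮w _ u>w rewrite dec-false (u Fin.<? w) u≮w | dec-true (w Fin.<? u) u>w
                                 | symmetric w u | Bool.∧-comm (χ w) (χ u) = refl

    coloring-of : ∀ (χ : Vertex G → Bool) → ∃[ φ ] class φ zero ≗ χ × class φ (suc zero) ≗ not ∘ χ
    coloring-of χ = (λ v → color (χ v)) , (λ v → p (χ v)) , (λ v → q (χ v))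
      where
      color : Bool → Fin 2
      color true  = zero
      color false = suc zero
      p : ∀ b → does (color b Fin.≟ zero) ≡ b
      p true  = refl
      p false = refl
      q : ∀ b → does (color b Fin.≟ suc zero) ≡ not b
      q true  = refl
      q false = refl

    LCP-intro : ∀ {k} χ → 2 * k ≤ twiceEdges G χ → 2 * k ≤ twiceEdges G (not ∘ χ) → G ∈[2, k ]-LCP
    LCP-intro {k} χ h₀ h₁ with coloring-of χ
    ... | φ , c₀ , c₁ = φ , λ where
        zero       → half zero (subst (2 * k ≤_) (sym (trans (2*load φ zero) (within-cong adj c₀ c₀))) h₀)
        (suc zero) → half (suc zero) (subst (2 * k ≤_) (sym (trans (2*load φ (suc zero)) (within-cong adj c₁ c₁))) h₁)
      where
      half : ∀ i → 2 * k ≤ 2 * load G φ i → k ≤ load G φ i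
      half i = ℕ.*-cancelˡ-≤ 2

    LCP-elim : ∀ {k} → G ∈[2, k ]-LCP →
      ∃[ χ ] 2 * k ≤ twiceEdges G χ × 2 * k ≤ twiceEdges G (not ∘ χ)
    LCP-elim {k} (φ , h) = class φ zero ,
      subst (2 * k ≤_) (2*load φ zero) (ℕ.*-monoʳ-≤ 2 (h zero)) ,
      subst (2 * k ≤_) (trans (2*load φ (suc zero)) (within-cong adj opposite opposite)) (ℕ.*-monoʳ-≤ 2 (h (suc zero)))
      where
      opposite : class φ (suc zero) ≗ not ∘ class φ zero
      opposite v = case (φ v)
        where
        case : ∀ i → does (i Fin.≟ suc zero) ≡ not (does (i Fin.≟ zero))
        case zero       = refl
        case (suc zero) = refl

    edges-all : ∀ χ → twiceEdges G χ + twiceEdges G (not ∘ χ) ≤ twiceEdges G all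
    edges-all χ = subst (_≤ twiceEdges G all)
      (trans (Σℕ.sum-cong-≗ (λ u → Σℕ.∑-distrib-+ (λ w → ind (adj u w ∧ (χ u ∧ χ w))) _))
             (Σℕ.∑-distrib-+ (λ u → ∑ (λ w → ind (adj u w ∧ (χ u ∧ χ w)))) _))
      (∑-mono-≤ λ u → ∑-mono-≤ λ w → disjoint (adj u w) (χ u) (χ w))
      where
      disjoint : ∀ a x y → ind (a ∧ (x ∧ y)) + ind (a ∧ (not x ∧ not y)) ≤ ind (a ∧ true)
      disjoint false _     _     = z≤n
      disjoint true  false false = ℕ.≤-refl
      disjoint true  false true  = z≤n
      disjoint true  true  false = z≤n
      disjoint true  true  true  = ℕ.≤-refl

    LCP-half : ∀ {k} → G ∈[2, k ]-LCP → 4 * k ≤ twiceEdges G all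
    LCP-half {k} lcp with LCP-elim lcp
    ... | χ , h₀ , h₁ = subst (_≤ twiceEdges G all) (four k) (ℕ.≤-trans (ℕ.+-mono-≤ h₀ h₁) (edges-all χ))
      where
      four : ∀ k → 2 * k + 2 * k ≡ 4 * k
      four = solve-∀

    others : Vertex G → Vertex G → Bool
    others v w = not (does (w Fin.≟ v))

    LCP-others : ∀ {k} v → G ∈[2, k ]-LCP → 2 * k ≤ twiceEdges G (others v)
    LCP-others {k} v lcp with LCP-elim lcp
    ... | χ , h₀ , h₁ with χ v in eq
    ...   | true  = ℕ.≤-trans h₁ (within-mono {A = adj} avoid)
      where
      avoid : ∀ w → not (χ w) ≡ true → others v w ≡ true
      avoid w χw with w Fin.≟ v
      ... | no _     = refl
      ... | yes refl = contradiction (trans (sym χw) (cong not eq)) λ ()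
    ...   | false = ℕ.≤-trans h₀ (within-mono {A = adj} avoid)
      where
      avoid : ∀ w → χ w ≡ true → others v w ≡ true
      avoid w χw with w Fin.≟ v
      ... | no _     = refl
      ... | yes refl = contradiction (trans (sym χw) eq) λ ()

  ∑-equal : ∀ {n} (x : Fin n) → ∑ (λ w → ind (does (w Fin.≟ x))) ≡ 1
  ∑-equal {suc n} zero    = cong suc (Σℕ.sum-replicate-zero n)
  ∑-equal {suc n} (suc x) = ∑-equal x

  module _ {n : ℕ} where
    open DecMembership (Fin._≟_ {n}) using (_∈?_)

    ∑-member : ∀ (xs : List (Fin n)) → ∑ (λ w → ind (does (w ∈? xs))) ≤ length xs
    ∑-member []       = ℕ.≤-reflexive (Σℕ.sum-replicate-zero n)
    ∑-member (x ∷ xs) = ℕ.≤-trans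
      (∑-mono-≤ λ w → ind-∨ (does (w Fin.≟ x)) (does (w ∈? xs)))
      (subst (_≤ suc (length xs))
        (sym (Σℕ.∑-distrib-+ (λ w → ind (does (w Fin.≟ x))) (λ w → ind (does (w ∈? xs)))))
        (ℕ.+-mono-≤ (ℕ.≤-reflexive (∑-equal x)) (∑-member xs)))
      where
      ind-∨ : ∀ a b → ind (a ∨ b) ≤ ind a + ind b
      ind-∨ true  _ = s≤s z≤n
      ind-∨ false _ = ℕ.≤-refl

    ends : List (Fin n × Fin n) → List (Fin n)
    ends []             = []
    ends ((u , w) ∷ es) = u ∷ w ∷ ends es

    length-ends : ∀ es → length (ends es) ≡ 2 * length es
    length-ends []       = refl
    length-ends (e ∷ es) = trans (cong (λ l → suc (suc l)) (length-ends es)) (step (length es))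
      where
      step : ∀ l → 2 + 2 * l ≡ 2 * (1 + l)
      step = solve-∀

    ends-∈ : ∀ {u w} es → (u , w) ∈ es → u ∈ ends es × w ∈ ends es
    ends-∈ (_ ∷ es) (here refl) = here refl , there (here refl)
    ends-∈ (_ ∷ es) (there e∈)  = let p , q = ends-∈ es e∈ in there (there p) , there (there q)

    ∉-ends : ∀ {v} es → All (λ (u , w) → u ≢ v × w ≢ v) es → ¬ v ∈ ends es
    ∉-ends (_ ∷ es) ((u≢v , _) All.∷ _)   (here refl)         = u≢v refl
    ∉-ends (_ ∷ es) ((_ , w≢v) All.∷ _)   (there (here refl)) = w≢v refl
    ∉-ends (_ ∷ es) (_ All.∷ avoid)       (there (there v∈))  = ∉-ends es avoid v∈

  module _ (G : Graph) where
    open Graph G using (order; adj; symmetric; irreflexive)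
    open DecMembership (Fin._≟_ {order}) using (_∈?_)

    -- Row `v` and column `v` of the table of ordered pairs each contain the star, and they meet
    -- only in the diagonal entry, which is 0. So row `v` pays for one copy, and each other row pays
    -- its entry in column `v` towards the second.
    twice-star≤ : ∀ χ v → χ v ≡ true → 2 * ∑ (λ w → ind (adj v w ∧ χ w)) ≤ twiceEdges G χ
    twice-star≤ χ v χv = subst (_≤ twiceEdges G χ) eq (∑-mono-≤ bound)
      where
      f : Vertex G → Vertex G → ℕ
      f u w = ind (adj u w ∧ (χ u ∧ χ w))
      S : ℕ
      S = ∑ (λ w → ind (adj v w ∧ χ w))
      row-v : ∑ (f v) ≡ S
      row-v = Σℕ.sum-cong-≗ λ w → cong (λ b → ind (adj v w ∧ (b ∧ χ w))) χv
      column-v : ∑ (λ u → f u v) ≡ S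
      column-v = trans (Σℕ.sum-cong-≗ λ u → cong₂ (λ a b → ind (a ∧ b)) (symmetric u v) (Bool.∧-comm (χ u) (χ v))) row-v
      bound : ∀ u → f u v + ind (does (u Fin.≟ v)) * S ≤ ∑ (f u)
      bound u with u Fin.≟ v
      ... | yes refl rewrite irreflexive u = ℕ.≤-reflexive (trans (ℕ.+-identityʳ S) (sym row-v))
      ... | no _     = subst (_≤ ∑ (f u)) (sym (ℕ.+-identityʳ (f u v))) (term≤∑ (f u) v)
      eq : ∑ (λ u → f u v + ind (does (u Fin.≟ v)) * S) ≡ 2 * S
      eq = begin
        ∑ (λ u → f u v + ind (does (u Fin.≟ v)) * S)       ≡⟨ Σℕ.∑-distrib-+ (λ u → f u v) _ ⟩
        ∑ (λ u → f u v) + ∑ (λ u → ind (does (u Fin.≟ v)) * S)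
          ≡⟨ cong₂ _+_ column-v (sym (Σℕ.*-distribʳ-sum S (λ u → ind (does (u Fin.≟ v))))) ⟩
        S + ∑ (λ u → ind (does (u Fin.≟ v))) * S           ≡⟨ cong (λ x → S + x * S) (∑-equal v) ⟩
        2 * S                                              ∎
        where open ≡-Reasoning

    -- k edges avoiding v have at most 2k ends, so at least k of the edges at v
    -- avoid all these ends.
    LCP-star : ∀ {k} v → 3 * k ≤ degree adj v → 2 * k ≤ twiceEdges G (others G v) → G ∈[2, k ]-LCP
    LCP-star {k} v 3k≤deg 2k≤others with coloring-of G (others G v)
    ... | φ , φ≗ , _ = LCP-intro G χ two-k (ℕ.≤-trans (ℕ.*-monoʳ-≤ 2 k≤S) (twice-star≤ (not ∘ χ) v χv))
      where
      avoiding chosen : List (Vertex G × Vertex G)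
      avoiding = filter (λ (u , w) → (φ u Fin.≟ zero) ×-dec (φ w Fin.≟ zero)) (edges G)
      chosen = take k avoiding

      length-chosen : length chosen ≡ k
      length-chosen = trans (List.length-take k avoiding) (ℕ.m≤n⇒m⊓n≡m (ℕ.*-cancelˡ-≤ 2
        (subst (2 * k ≤_) (sym (trans (2*load G φ zero) (within-cong adj φ≗ φ≗))) 2k≤others)))

      avoids : ∀ u → φ u ≡ zero → u ≢ v
      avoids u φu refl = contradiction
        (trans (sym (dec-true (φ u Fin.≟ zero) φu)) (trans (φ≗ u) (cong not (dec-true (u Fin.≟ u) refl)))) λ ()

      χ : Vertex G → Bool
      χ w = does (w ∈? ends chosen)

      χv : not (χ v) ≡ true
      χv = cong not (dec-false (v ∈? ends chosen) (∉-ends chosen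
        (All.map (λ {(u , w)} (φu , φw) → avoids u φu , avoids w φw) (take⁺ k (all-filter _ (edges G))))))

      two-k : 2 * k ≤ twiceEdges G χ
      two-k with coloring-of G χ
      -- The chosen edges form a sublist of all edges, and every one of them survives the filter
      -- that defines the load, so their number `k` is a lower bound.
      ... | ψ , ψ≗ , _ = subst (2 * k ≤_) (trans (2*load G ψ zero) (within-cong adj ψ≗ ψ≗)) (ℕ.*-monoʳ-≤ 2 (begin
        k                           ≡⟨ sym length-chosen ⟩
        length chosen               ≡⟨ cong length (sym (List.filter-all P? inside)) ⟩
        length (filter P? chosen)   ≤⟨ length-mono-≤ (filter⁺ P? P? (λ { refl p → p }) (⊆-trans (take-⊆ k avoiding) (filter-⊆ _ (edges G)))) ⟩
        length (filter P? (edges G)) ∎))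
        where
        open ℕ.≤-Reasoning
        P? : Decidable (λ ((u , w) : Vertex G × Vertex G) → ψ u ≡ zero × ψ w ≡ zero)
        P? (u , w) = (ψ u Fin.≟ zero) ×-dec (ψ w Fin.≟ zero)
        ψ-zero : ∀ u → u ∈ ends chosen → ψ u ≡ zero
        ψ-zero u u∈ = does-true (ψ u Fin.≟ zero) (trans (ψ≗ u) (dec-true (u ∈? ends chosen) u∈))
          where
          does-true : ∀ {A : Set} (a? : Dec A) → does a? ≡ true → A
          does-true (yes a) _ = a
        inside : All (λ (u , w) → ψ u ≡ zero × ψ w ≡ zero) chosen
        inside = All.tabulate λ {(u , w)} e∈ → let p , q = ends-∈ chosen e∈ in ψ-zero u p , ψ-zero w q

      k≤S : k ≤ ∑ (λ w → ind (adj v w ∧ not (χ w)))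
      k≤S = ℕ.+-cancelʳ-≤ (2 * k) k _ (begin
        k + 2 * k      ≤⟨ 3k≤deg ⟩
        degree adj v   ≤⟨ ∑-mono-≤ (λ w → split (adj v w) (χ w)) ⟩
        ∑ (λ w → ind (adj v w ∧ not (χ w)) + ind (χ w))
                       ≡⟨ Σℕ.∑-distrib-+ (λ w → ind (adj v w ∧ not (χ w))) (λ w → ind (χ w)) ⟩
        ∑ (λ w → ind (adj v w ∧ not (χ w))) + ∑ (λ w → ind (χ w))
                       ≤⟨ ℕ.+-monoʳ-≤ _ (ℕ.≤-trans (∑-member (ends chosen)) (ℕ.≤-reflexive (trans (length-ends chosen) (cong (2 *_) length-chosen)))) ⟩
        ∑ (λ w → ind (adj v w ∧ not (χ w))) + 2 * k ∎)
        where
        open ℕ.≤-Reasoning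
        split : ∀ a b → ind a ≤ ind (a ∧ not b) + ind b
        split false _     = z≤n
        split true  false = s≤s z≤n
        split true  true  = s≤s z≤n

-- From signs to a coloring with m / 8 edges in both classes.

module BalancedColoring where
  open SignAssignment
  open EdgeCounting
  open import Data.Integer.Base using (ℤ; +_; 0ℤ; 1ℤ; -1ℤ; _+_; _*_; _-_; _≤_; _<_; +≤+; +<+)
  open import Data.Integer.Tactic.RingSolver using (solve-∀)
  open import Algebra.Properties.Semiring.Sum ℤ.+-*-semiring as Σℤ using () renaming (sum to ∑)
  import Data.Nat.Tactic.RingSolver as ℕ-Solver
  open import Algebra.Properties.Semiring.Sum ℕ.+-*-semiring as Σℕ using ()

  pos-sum : ∀ {n} (f : Fin n → ℕ) → + Σℕ.sum f ≡ ∑ (λ v → + f v)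
  pos-sum {zero}  f = refl
  pos-sum {suc n} f = cong (_+_ (+ f zero)) (pos-sum (f ∘ suc))

  bit-cases : ∀ b → + ind b ≡ 0ℤ ⊎ + ind b ≡ 1ℤ
  bit-cases false = inj₁ refl
  bit-cases true  = inj₂ refl

  dot-affine : ∀ {n} (f s : Fin n → ℤ) τ → dot f (λ v → 1ℤ + τ * s v) ≡ ∑ f + τ * dot f s
  dot-affine f s τ = trans (dot-+ f (λ _ → 1ℤ) (λ v → τ * s v))
    (cong₂ _+_ (Σℤ.sum-cong-≗ (λ v → ℤ.*-identityʳ (f v))) (dot-scale τ f s))

  module _ (G : Graph) where
    open Graph G using (order; adj; symmetric; irreflexive)

    weight : Vertex G → Vertex G → ℤ
    weight u w = + ind (adj u w)

    open Signing weight (λ u w → cong (λ b → + ind b) (symmetric u w)) (λ v → cong (λ b → + ind b) (irreflexive v))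
      (λ u w → bit-cases (adj u w))
      public

    d≡degree : ∀ v → d v ≡ + degree adj v
    d≡degree v = sym (pos-sum (λ w → ind (adj v w)))

    M≡twiceEdges : M ≡ + twiceEdges G all
    M≡twiceEdges = sym (trans (pos-sum (λ u → Σℕ.sum (λ w → ind (adj u w ∧ true))))
      (Σℤ.sum-cong-≗ λ u → trans (pos-sum (λ w → ind (adj u w ∧ true)))
      (Σℤ.sum-cong-≗ λ w → cong (λ b → + ind b) (Bool.∧-identityʳ (adj u w)))))

    -- For a signing `s` the vector `x` is 2 on the class of the sign `τ` and 0 on the other. This
    -- expands the form at `x`; `twiceEdges-quadratic` evaluates the same form by counting.
    quadratic-affine : ∀ s {τ} → IsSign τ →
      let x = λ v → 1ℤ + τ * s v in dot x (λ u → dot (weight u) x) ≡ M + + 2 * (τ * L s) + Q s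
    quadratic-affine s {τ} τ± = begin
      dot x (λ u → dot (weight u) x)             ≡⟨ Σℤ.sum-cong-≗ (λ u → cong (_*_ (x u)) (dot-affine (weight u) s τ)) ⟩
      dot x (λ u → d u + τ * g u)                ≡⟨ dot-+ x d (λ u → τ * g u) ⟩
      dot x d + dot x (λ u → τ * g u)            ≡⟨ cong₂ _+_ (comm-affine d) (trans (dot-scale τ x g) (cong (_*_ τ) (comm-affine g))) ⟩
      (M + τ * L s) + τ * (∑ g + τ * dot g s)    ≡⟨ cong₂ (λ y z → (M + τ * L s) + τ * (y + τ * z)) sum-g (dot-comm g s) ⟩
      (M + τ * L s) + τ * (L s + τ * Q s)        ≡⟨ collect M (L s) (Q s) τ ⟩
      M + + 2 * (τ * L s) + τ * τ * Q s          ≡⟨ cong (_+_ (M + + 2 * (τ * L s))) (trans (cong (_* Q s) (sign-square τ±)) (ℤ.*-identityˡ (Q s))) ⟩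
      M + + 2 * (τ * L s) + Q s                  ∎
      where
      open ≡-Reasoning
      x g : Vertex G → ℤ
      x v = 1ℤ + τ * s v
      g u = dot (weight u) s
      comm-affine : ∀ f → dot x f ≡ ∑ f + τ * dot f s
      comm-affine f = trans (dot-comm x f) (dot-affine f s τ)
      sum-g : ∑ g ≡ L s
      sum-g = trans (Σℤ.∑-comm (λ u w → weight u w * s w)) (Σℤ.sum-cong-≗ λ w →
        trans (sym (Σℤ.*-distribʳ-sum (s w) (λ u → weight u w)))
              (cong (_* s w) (Σℤ.sum-cong-≗ λ u → cong (λ b → + ind b) (symmetric u w))))
      collect : ∀ M l q τ → (M + τ * l) + τ * (l + τ * q) ≡ M + + 2 * (τ * l) + τ * τ * q
      collect = solve-∀

    twiceEdges-quadratic : ∀ (χ : Vertex G → Bool) (x : Vertex G → ℤ) → (∀ v → x v ≡ + 2 * + ind (χ v)) →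
      dot x (λ u → dot (weight u) x) ≡ + 4 * + twiceEdges G χ
    twiceEdges-quadratic χ x x≡ = begin
      dot x (λ u → dot (weight u) x)
        ≡⟨ Σℤ.sum-cong-≗ (λ u → cong₂ _*_ (x≡ u) (Σℤ.sum-cong-≗ (λ w → cong (_*_ (weight u w)) (x≡ w)))) ⟩
      dot (λ v → + 2 * y v) (λ u → dot (weight u) (λ w → + 2 * y w))
        ≡⟨ Σℤ.sum-cong-≗ (λ u → cong (_*_ (+ 2 * y u)) (dot-scale (+ 2) (weight u) y)) ⟩
      dot (λ v → + 2 * y v) (λ u → + 2 * g u)
        ≡⟨ Σℤ.sum-cong-≗ (λ u → four (y u) (g u)) ⟩
      ∑ (λ u → + 4 * (y u * g u))
        ≡⟨ sym (Σℤ.*-distribˡ-sum (+ 4) (λ u → y u * g u)) ⟩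
      + 4 * ∑ (λ u → y u * g u)
        ≡⟨ cong (_*_ (+ 4)) (Σℤ.sum-cong-≗ λ u → trans (Σℤ.*-distribˡ-sum (y u) (λ w → weight u w * y w))
             (trans (Σℤ.sum-cong-≗ λ w → entry (adj u w) (χ u) (χ w)) (sym (pos-sum (λ w → ind (adj u w ∧ (χ u ∧ χ w))))))) ⟩
      + 4 * ∑ (λ u → + Σℕ.sum (λ w → ind (adj u w ∧ (χ u ∧ χ w))))
        ≡⟨ cong (_*_ (+ 4)) (sym (pos-sum (λ u → Σℕ.sum (λ w → ind (adj u w ∧ (χ u ∧ χ w)))))) ⟩
      + 4 * + twiceEdges G χ ∎
      where
      open ≡-Reasoning
      y g : Vertex G → ℤ
      y v = + ind (χ v)
      g u = dot (weight u) y
      four : ∀ y g → + 2 * y * (+ 2 * g) ≡ + 4 * (y * g)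
      four = solve-∀
      entry : ∀ a b c → + ind b * (+ ind a * + ind c) ≡ + ind (a ∧ (b ∧ c))
      entry false false _     = refl
      entry false true  false = refl
      entry false true  true  = refl
      entry true  false false = refl
      entry true  false true  = refl
      entry true  true  false = refl
      entry true  true  true  = refl

    module _ (κ : ℤ) (κ≡64 : κ ≡ + 64) (k : ℕ) (deg≤ : ∀ v → degree adj v ℕ.≤ 3 ℕ.* k) (0<m : 0 ℕ.< twiceEdges G all)
      (large : + 64 * (+ (3 ℕ.* k) * + (3 ℕ.* k)) + + 16 * (κ * κ * + twiceEdges G all)
        ≤ + 3 * (+ twiceEdges G all * + twiceEdges G all)) where

      private
        0<M : 0ℤ < M
        0<M = subst (0ℤ <_) (sym M≡twiceEdges) (+<+ 0<m)

        S : Signs κ κ≡64 (+ (3 ℕ.* k))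
        S = assignAllSigns κ κ≡64 (+ (3 ℕ.* k)) (λ v → subst (_≤ + (3 ℕ.* k)) (sym (d≡degree v)) (+≤+ (deg≤ v))) (+≤+ z≤n)

        open Bounds κ κ≡64 (+ (3 ℕ.* k)) 0<M S using (signs; final)
        open Signs S using (s)

        positive-class : Vertex G → Bool
        positive-class v = does (s v ℤ.≟ 1ℤ)

        -- `8 * twiceEdges G χ` is twice the form M + 2 τ L + Q, so the claim is the inequality of
        -- `final`.
        fair : ∀ χ {τ} → IsSign τ → (∀ v → 1ℤ + τ * s v ≡ + 2 * + ind (χ v)) → twiceEdges G all ℕ.≤ 8 ℕ.* twiceEdges G χ
        fair χ {τ} τ± x≡ = ℤ.drop‿+≤+ (subst (+ twiceEdges G all ≤_) (sym (ℤ.pos-* 8 (twiceEdges G χ)))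
          (≤-by _ (final (subst (λ m → + 64 * (+ (3 ℕ.* k) * + (3 ℕ.* k)) + + 16 * (κ * κ * m) ≤ + 3 * (m * m)) (sym M≡twiceEdges) large) τ τ±)
            (trans (cong (_- + twiceEdges G all) (eight (+ twiceEdges G χ)))
            (trans (cong₂ (λ a b → + 2 * a - b) (trans (sym (twiceEdges-quadratic χ _ x≡)) (quadratic-affine s τ±)) (sym M≡twiceEdges))
                   (collect M (τ * L s) (Q s))))))
          where
          eight : ∀ x → + 8 * x ≡ + 2 * (+ 4 * x)
          eight = solve-∀
          collect : ∀ M l q → + 2 * (M + + 2 * l + q) - M ≡ M + + 4 * l + + 2 * q
          collect = solve-∀

      fairColoring : ∃[ χ ] twiceEdges G all ℕ.≤ 8 ℕ.* twiceEdges G χ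
                           × twiceEdges G all ℕ.≤ 8 ℕ.* twiceEdges G (not ∘ χ)
      fairColoring = positive-class ,
        fair positive-class (inj₁ refl) (λ v → plus (signs v)) ,
        fair (not ∘ positive-class) (inj₂ refl) (λ v → minus (signs v))
        where
        plus : ∀ {x} → IsSign x → 1ℤ + 1ℤ * x ≡ + 2 * + ind (does (x ℤ.≟ 1ℤ))
        plus (inj₁ refl) = refl
        plus (inj₂ refl) = refl
        minus : ∀ {x} → IsSign x → 1ℤ + -1ℤ * x ≡ + 2 * + ind (not (does (x ℤ.≟ 1ℤ)))
        minus (inj₁ refl) = refl
        minus (inj₂ refl) = refl

    twiceEdges-even : ∀ χ → ∃[ l ] twiceEdges G χ ≡ 2 ℕ.* l
    twiceEdges-even χ with coloring-of G χ
    ... | φ , φ≗ , _ = load G φ zero , sym (trans (2*load G φ zero) (within-cong adj φ≗ φ≗))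

    -- With D = 3k and 16k ≤ m + 15 the term 64 D² is about 9/4 m², where `m` counts ordered pairs.
    -- The remaining 3/4 m² of the allowed 3 m² absorbs 16 κ² m and the rounding as soon as m ≥ 32
    -- κ².
    LCP-balanced : ∀ κ → κ ≡ + 64 → ∀ k → (∀ v → degree adj v ℕ.≤ 3 ℕ.* k) → 0 ℕ.< twiceEdges G all →
      16 ℕ.* k ℕ.≤ twiceEdges G all ℕ.+ 15 → + 32 * (κ * κ) ≤ + twiceEdges G all → G ∈[2, k ]-LCP
    LCP-balanced κ κ≡64 k deg≤ 0<m 16k≤ big = fromFair (fairColoring κ κ≡64 k deg≤ 0<m
        (subst (λ x → + 64 * (x * x) + + 16 * (κ * κ * + m) ≤ + 3 * (+ m * + m)) (sym (ℤ.pos-* 3 k)) large))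
      where
      m : ℕ
      m = twiceEdges G all
      κκ≥100 : + 100 ≤ κ * κ
      κκ≥100 = subst (λ κ → + 100 ≤ κ * κ) (sym κ≡64) (+≤+ (ℕ.≤ᵇ⇒≤ 100 4096 _))
      16k≤m : + 16 * + k ≤ + m + + 15
      16k≤m = subst (_≤ + m + + 15) (ℤ.pos-* 16 k) (+≤+ 16k≤)
      -- The hypothesis 16k ≤ m + 15 enters as a difference of squares. Its rounding leaves 2025 = 9
      -- · 15², and 905 is chosen so that the terms linear in `m` without `κκ` cancel: 270 + 2025 +
      -- 905 = 32 · 100.
      identity : ∀ κκ k m →
        + 9 * ((m + + 15 - + 16 * k) * (m + + 15 + + 16 * k)) + + 3 * (m * (m - + 32 * κκ))
          + + 32 * ((κκ - + 100) * m) + + 2025 * (m - 1ℤ) + + 905 * m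
        ≡ + 4 * (+ 3 * (m * m) - (+ 64 * (+ 3 * k * (+ 3 * k)) + + 16 * (κκ * m)))
      identity = solve-∀
      combine : ∀ c₁ c₂ c₃ c₄ c₅ {a b c d e y} → 0ℤ ≤ a → 0ℤ ≤ b → 0ℤ ≤ c → 0ℤ ≤ d → 0ℤ ≤ e →
        + c₁ * a + + c₂ * b + + c₃ * c + + c₄ * d + + c₅ * e ≡ y → 0ℤ ≤ y
      combine c₁ c₂ c₃ c₄ c₅ {a} {b} {c} {d} {e} pa pb pc pd pe eq = subst (0ℤ ≤_) eq
        (+-nonneg (+-nonneg (+-nonneg (+-nonneg
          (*-nonneg {+ c₁} {a} (+≤+ z≤n) pa) (*-nonneg {+ c₂} {b} (+≤+ z≤n) pb))
          (*-nonneg {+ c₃} {c} (+≤+ z≤n) pc)) (*-nonneg {+ c₄} {d} (+≤+ z≤n) pd)) (*-nonneg {+ c₅} {e} (+≤+ z≤n) pe))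
      large : + 64 * (+ 3 * + k * (+ 3 * + k)) + + 16 * (κ * κ * + m) ≤ + 3 * (+ m * + m)
      large = ℤ.0≤i-j⇒j≤i (ℤ.*-cancelˡ-≤-pos 0ℤ _ (+ 4) (combine 9 3 32 2025 905
        (*-nonneg (gap 16k≤m) (subst (λ x → 0ℤ ≤ + m + + 15 + x) (ℤ.pos-* 16 k) (+≤+ z≤n)))
        (*-nonneg {+ m} (+≤+ z≤n) (gap big))
        (*-nonneg {κ * κ - + 100} {+ m} (gap κκ≥100) (+≤+ z≤n))
        (gap {1ℤ} {+ m} (+≤+ 0<m))
        (+≤+ {0} {m} z≤n)
        (identity (κ * κ) (+ k) (+ m))))
      -- Evenness recovers what rounding `k` up has cost: with 2l ordered pairs in the class, 16k ≤
      -- m + 15 < 16 (l + 1), hence k ≤ l.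
      round : ∀ χ → m ℕ.≤ 8 ℕ.* twiceEdges G χ → 2 ℕ.* k ℕ.≤ twiceEdges G χ
      round χ m≤8x with twiceEdges-even χ
      ... | l , eq rewrite eq = ℕ.*-monoʳ-≤ 2 (ℕ.≤-pred (ℕ.*-cancelˡ-< 16 k (suc l) (begin-strict
        16 ℕ.* k                    ≤⟨ 16k≤ ⟩
        m ℕ.+ 15                    <⟨ ℕ.+-monoʳ-< m (ℕ.n<1+n 15) ⟩
        m ℕ.+ 16                    ≤⟨ ℕ.+-monoˡ-≤ 16 m≤8x ⟩
        8 ℕ.* (2 ℕ.* l) ℕ.+ 16      ≡⟨ sixteen l ⟩
        16 ℕ.* suc l                ∎)))
        where
        open ℕ.≤-Reasoning
        sixteen : ∀ l → 8 ℕ.* (2 ℕ.* l) ℕ.+ 16 ≡ 16 ℕ.* suc l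
        sixteen = ℕ-Solver.solve-∀
      fromFair : ∃[ χ ] m ℕ.≤ 8 ℕ.* twiceEdges G χ × m ℕ.≤ 8 ℕ.* twiceEdges G (not ∘ χ) → G ∈[2, k ]-LCP
      fromFair (χ , h₀ , h₁) = LCP-intro G χ (round χ h₀) (round (not ∘ χ) h₁)

-- The program, with verified results and running times.

module Machine where
  open EdgeCounting
  open import Data.Nat.Base using (_+_; _*_; _∸_; _^_; _⊓_; _⊔_; _≤_)
  open import Data.Nat.Tactic.RingSolver using (solve-∀)
  open import Algebra.Properties.Semiring.Sum ℕ.+-*-semiring using () renaming (sum to ∑)

  -- Register 0 holds a value and register 1 a stack.
  embed : Expression 1 → Expression 2
  embed (var i)    = var (inject₁ i)
  embed nil        = nil
  embed (cons e f) = cons (embed e) (embed f)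
  embed (hd e)     = hd (embed e)
  embed (tl e)     = tl (embed e)

  value : Expression 1 → Tree → Tree
  value e x = ⟦ e ⟧ (x ∷ [])

  value-embed : ∀ e x s → ⟦ embed e ⟧ (x ∷ s ∷ []) ≡ value e x
  value-embed (var zero) x s = refl
  value-embed nil        x s = refl
  value-embed (cons e f) x s = cong₂ _∙_ (value-embed e x s) (value-embed f x s)
  value-embed (hd e)     x s = cong head (value-embed e x s)
  value-embed (tl e)     x s = cong tail (value-embed e x s)

  cost-embed : ∀ e → cost (embed e) ≡ cost e
  cost-embed (var _)    = refl
  cost-embed nil        = refl
  cost-embed (cons e f) = cong₂ (λ a b → suc (a + b)) (cost-embed e) (cost-embed f)
  cost-embed (hd e)     = cong suc (cost-embed e)
  cost-embed (tl e)     = cong suc (cost-embed e)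

  -- The stack is arbitrary and is restored, so these statements compose under `call`. Time is only
  -- bounded from above, which lets one bound cover branches of different cost.
  Runs : Command 2 → Tree → Tree → ℕ → Set
  Runs C x y t = ∀ s → ∃[ t′ ] t′ ≤ t × ⟨ C , x ∷ s ∷ [] ⟩⇓ y ∷ s ∷ [] in-time t′

  set : Expression 1 → Command 2
  set e = zero := embed e

  ifᶜ_then_else_ : Expression 1 → Command 2 → Command 2 → Command 2
  ifᶜ e then C else D = if embed e then C else D

  -- A subroutine call. The old value is kept behind the result, so later expressions can still
  -- reach everything through `tl`.
  call : Expression 1 → Command 2 → Command 2
  call e C = suc zero := cons (var zero) (var (suc zero))
           ⨾ zero := embed e
           ⨾ C
           ⨾ zero := cons (var zero) (hd (var (suc zero)))
           ⨾ suc zero := tl (var (suc zero))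

  Runs-≤ : ∀ {C x y t u} → t ≤ u → Runs C x y t → Runs C x y u
  Runs-≤ t≤u r s with r s
  ... | t′ , t′≤t , p = t′ , ℕ.≤-trans t′≤t t≤u , p

  Runs-result : ∀ {C x y z t} → y ≡ z → Runs C x y t → Runs C x z t
  Runs-result refl r = r

  Runs-set : ∀ e {x} → Runs (set e) x (value e x) (suc (cost e))
  Runs-set e {x} s = _ , ℕ.≤-reflexive (cong suc (cost-embed e)) ,
    subst (λ y → ⟨ set e , x ∷ s ∷ [] ⟩⇓ y ∷ s ∷ [] in-time suc (cost (embed e))) (value-embed e x s) assign

  infixr 5 _then_

  _then_ : ∀ {C D x y z t u} → Runs C x y t → Runs D y z u → Runs (C ⨾ D) x z (t + u)
  (r then q) s with r s | q s
  ... | _ , le₁ , p₁ | _ , le₂ , p₂ = _ , ℕ.+-mono-≤ le₁ le₂ , seq p₁ p₂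

  Runs-true : ∀ e {C D x y l r t} → value e x ≡ l ∙ r → Runs C x y t →
    Runs (ifᶜ e then C else D) x y (suc (cost e) + t)
  Runs-true e {x = x} eq q s with q s
  ... | _ , le , p = _ , ℕ.+-mono-≤ (ℕ.≤-reflexive (cong suc (cost-embed e))) le ,
    if-true (trans (value-embed e x s) eq) p

  Runs-false : ∀ e {C D x y t} → value e x ≡ nil → Runs D x y t →
    Runs (ifᶜ e then C else D) x y (suc (cost e) + t)
  Runs-false e {x = x} eq q s with q s
  ... | _ , le , p = _ , ℕ.+-mono-≤ (ℕ.≤-reflexive (cong suc (cost-embed e))) le ,
    if-false (trans (value-embed e x s) eq) p

  Runs-while-false : ∀ e {C x} → value e x ≡ nil → Runs (while embed e loop C) x x (suc (cost e))
  Runs-while-false e {x = x} eq s = _ , ℕ.≤-reflexive (cong suc (cost-embed e)) ,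
    while-false (trans (value-embed e x s) eq)

  Runs-while-true : ∀ e {C x y z l r t u} → value e x ≡ l ∙ r → Runs C x y t → Runs (while embed e loop C) y z u →
    Runs (while embed e loop C) x z (suc (cost e) + t + u)
  Runs-while-true e {x = x} eq q q′ s with q s | q′ s
  ... | _ , le , p | _ , le′ , p′ = _ ,
    ℕ.+-mono-≤ (ℕ.+-mono-≤ (ℕ.≤-reflexive (cong suc (cost-embed e))) le) le′ ,
    while-true (trans (value-embed e x s) eq) p p′

  Runs-call : ∀ e {C x y t} → Runs C (value e x) y t → Runs (call e C) x (y ∙ x) (13 + cost e + t)
  Runs-call e {C} {x} {y} {t} r s with r (x ∙ s)
  ... | t′ , le , p = _ ,
    ℕ.≤-trans (ℕ.≤-reflexive (trans (cong (λ c → 4 + (suc c + (t′ + 8))) (cost-embed e)) (arrange (cost e) t′)))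
              (ℕ.+-monoʳ-≤ (13 + cost e) le) ,
    seq assign (seq (subst (λ v → ⟨ zero := embed e , x ∷ (x ∙ s) ∷ [] ⟩⇓ v ∷ (x ∙ s) ∷ [] in-time suc (cost (embed e)))
                           (value-embed e x (x ∙ s)) assign)
               (seq p (seq assign assign)))
    where
    arrange : ∀ c t → 4 + (suc c + (t + 8)) ≡ 13 + c + t
    arrange = solve-∀

  ⋆ : Expression 1
  ⋆ = var zero

  foldBody : Command 2 → Command 2
  foldBody C = call (cons (hd (hd ⋆)) (tl ⋆)) C ⨾ set (cons (tl (hd (tl ⋆))) (hd ⋆))

  foldLoop : Command 2 → Command 2
  foldLoop C = while embed (hd ⋆) loop foldBody C

  -- A left fold: the value is a list paired with an accumulator, and `C` turns the head paired with
  -- the accumulator into the new accumulator.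
  fold : Command 2 → Command 2
  fold C = foldLoop C ⨾ set (tl ⋆)

  -- A round costs 3 for the test and 27 for the bookkeeping around `C`; the final 6 are the failing
  -- test and the last assignment.
  foldTime : ℕ → ℕ → ℕ
  foldTime zero    t = 6
  foldTime (suc k) t = (30 + t) + foldTime k t

  Runs-fold-nil : ∀ {C a} → Runs (fold C) (nil ∙ a) a 6
  Runs-fold-nil s = _ , ℕ.≤-refl , seq (while-false refl) assign

  Runs-foldBody : ∀ {C h l a a′ t} → Runs C (h ∙ a) a′ t → Runs (foldBody C) ((h ∙ l) ∙ a) (l ∙ a′) (27 + t)
  Runs-foldBody {t = t} r = Runs-≤ (ℕ.≤-reflexive (collect t))
    (Runs-call (cons (hd (hd ⋆)) (tl ⋆)) r then Runs-set (cons (tl (hd (tl ⋆))) (hd ⋆)))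
    where
    collect : ∀ t → (19 + t) + 8 ≡ 27 + t
    collect = solve-∀

  -- Every run of `fold C` is a run of the loop followed by the last assignment. Splitting the given
  -- run there allows one more round to be put in front of the loop.
  Runs-fold-cons : ∀ {C h l a a′ z t u} → Runs C (h ∙ a) a′ t → Runs (fold C) (l ∙ a′) z u →
    Runs (fold C) ((h ∙ l) ∙ a) z ((30 + t) + u)
  Runs-fold-cons {C} {h} {l} {a} {a′} {z} {t} {u} r q s = glue (Runs-foldBody r s) (q s)
    where
    arrange : ∀ a b c → (3 + a + b) + c ≡ 3 + (a + (b + c))
    arrange = solve-∀
    glue : ∃[ t₁ ] t₁ ≤ 27 + t × ⟨ foldBody C , ((h ∙ l) ∙ a) ∷ s ∷ [] ⟩⇓ (l ∙ a′) ∷ s ∷ [] in-time t₁ →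
           ∃[ t₂ ] t₂ ≤ u × ⟨ fold C , (l ∙ a′) ∷ s ∷ [] ⟩⇓ z ∷ s ∷ [] in-time t₂ →
           ∃[ t₃ ] t₃ ≤ 30 + t + u × ⟨ fold C , ((h ∙ l) ∙ a) ∷ s ∷ [] ⟩⇓ z ∷ s ∷ [] in-time t₃
    glue (t₁ , le₁ , p₁) (_ , le₂ , seq {s = t₂} {t = t₃} p₂ p₃) = _ ,
      ℕ.≤-trans (ℕ.≤-reflexive (arrange t₁ t₂ t₃)) (ℕ.+-monoʳ-≤ 3 (ℕ.+-mono-≤ le₁ le₂)) ,
      seq (while-true refl p₁ p₂) p₃

  t₁ t₂ t₃ t₄ h₀ h₁ h₂ h₃ h₄ : Expression 1
  t₁ = tl ⋆
  t₂ = tl t₁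
  t₃ = tl t₂
  t₄ = tl t₃
  h₀ = hd ⋆
  h₁ = hd t₁
  h₂ = hd t₂
  h₃ = hd t₃
  h₄ = hd t₄

  foldTime-mono : ∀ {j k} t → j ≤ k → foldTime j t ≤ foldTime k t
  foldTime-mono {k = zero}  t z≤n     = ℕ.≤-refl
  foldTime-mono {k = suc k} t z≤n     = ℕ.≤-trans (foldTime-mono t (z≤n {k})) (ℕ.m≤n+m _ _)
  foldTime-mono             t (s≤s p) = ℕ.+-monoʳ-≤ (30 + t) (foldTime-mono t p)

  -- Colorings are lists of colors, indexed by the vertices and continued by
  -- false; so the end of the list may be treated as a vertex of color false.
  colors : List Bool → Tree
  colors c = list (map bit c)

  first : List Bool → Bool
  first []      = false
  first (b ∷ c) = b

  rest : List Bool → List Bool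
  rest []      = []
  rest (b ∷ c) = c

  dropRest : ℕ → List Bool → List Bool
  dropRest zero    c = c
  dropRest (suc n) c = dropRest n (rest c)

  at : ∀ {n} → List Bool → Fin n → Bool
  at c zero    = first c
  at c (suc v) = at (rest c) v

  row : ∀ {n} → (Fin n → Bool) → Tree
  row r = list (tabulate (bit ∘ r))

  matrix : ∀ {m n} → (Fin m → Fin n → Bool) → Tree
  matrix A = list (tabulate (row ∘ A))

  -- Counting the ordered pairs inside both color classes.

  next : Expression 1 → Expression 1 → Command 2
  next m₀ m₁ = set (cons (tl h₁) (cons h₂ (cons m₀ m₁)))

  -- The value holds, in this order, a matrix entry, the colors of the remaining columns, the color
  -- of the row, and the counters for the colors `false` and `true`.
  countStep : Command 2
  countStep =
    ifᶜ h₀ then (ifᶜ hd h₁ then (ifᶜ h₂ then next h₃ (cons nil t₄) else next h₃ t₄)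
                          else (ifᶜ h₂ then next h₃ t₄ else next (cons nil h₃) t₄))
           else next h₃ t₄

  Runs-countStep : ∀ a b c m₀ m₁ → Runs countStep
    (bit a ∙ (colors c ∙ (bit b ∙ (unary m₀ ∙ unary m₁))))
    (colors (rest c) ∙ (bit b ∙ (unary (ind (a ∧ (not b ∧ not (first c))) + m₀)
                                ∙ unary (ind (a ∧ (b ∧ first c)) + m₁)))) 50
  Runs-countStep false b []      m₀ m₁ =
    Runs-≤ (ℕ.≤ᵇ⇒≤ _ _ _) (Runs-false h₀ refl (Runs-set _))
  Runs-countStep false b (_ ∷ c) m₀ m₁ =
    Runs-≤ (ℕ.≤ᵇ⇒≤ _ _ _) (Runs-false h₀ refl (Runs-set _))
  Runs-countStep true true [] m₀ m₁ =
    Runs-≤ (ℕ.≤ᵇ⇒≤ _ _ _) (Runs-true h₀ refl (Runs-false (hd h₁) refl (Runs-true h₂ refl (Runs-set _))))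
  Runs-countStep true true (false ∷ c) m₀ m₁ =
    Runs-≤ (ℕ.≤ᵇ⇒≤ _ _ _) (Runs-true h₀ refl (Runs-false (hd h₁) refl (Runs-true h₂ refl (Runs-set _))))
  Runs-countStep true true (true ∷ c) m₀ m₁ =
    Runs-≤ (ℕ.≤ᵇ⇒≤ _ _ _) (Runs-true h₀ refl (Runs-true (hd h₁) refl (Runs-true h₂ refl (Runs-set _))))
  Runs-countStep true false [] m₀ m₁ =
    Runs-≤ (ℕ.≤ᵇ⇒≤ _ _ _) (Runs-true h₀ refl (Runs-false (hd h₁) refl (Runs-false h₂ refl (Runs-set _))))
  Runs-countStep true false (false ∷ c) m₀ m₁ =
    Runs-≤ (ℕ.≤ᵇ⇒≤ _ _ _) (Runs-true h₀ refl (Runs-false (hd h₁) refl (Runs-false h₂ refl (Runs-set _))))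
  Runs-countStep true false (true ∷ c) m₀ m₁ =
    Runs-≤ (ℕ.≤ᵇ⇒≤ _ _ _) (Runs-true h₀ refl (Runs-true (hd h₁) refl (Runs-false h₂ refl (Runs-set _))))

  shift-sum : ∀ a b c → a + (b + c) ≡ (b + a) + c
  shift-sum = solve-∀

  Runs-countRow : ∀ {n} (r : Fin n → Bool) b c m₀ m₁ → Runs (fold countStep)
    (row r ∙ (colors c ∙ (bit b ∙ (unary m₀ ∙ unary m₁))))
    (colors (dropRest n c) ∙ (bit b ∙ (unary (∑ (λ w → ind (r w ∧ (not b ∧ not (at c w)))) + m₀)
                                      ∙ unary (∑ (λ w → ind (r w ∧ (b ∧ at c w))) + m₁))))
    (foldTime n 50)
  Runs-countRow {zero}  r b c m₀ m₁ = Runs-fold-nil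
  Runs-countRow {suc n} r b c m₀ m₁ = Runs-fold-cons (Runs-countStep (r zero) b c m₀ m₁)
    (Runs-result (cong₂ (λ k₀ k₁ → colors (dropRest n (rest c)) ∙ (bit b ∙ (unary k₀ ∙ unary k₁)))
      (shift-sum (∑ (λ w → ind (r (suc w) ∧ (not b ∧ not (at (rest c) w))))) (ind (r zero ∧ (not b ∧ not (first c)))) m₀)
      (shift-sum (∑ (λ w → ind (r (suc w) ∧ (b ∧ at (rest c) w)))) (ind (r zero ∧ (b ∧ first c))) m₁))
      (Runs-countRow (r ∘ suc) b (rest c) _ _))

  evaluateStep : Command 2
  evaluateStep = call (cons h₀ (cons h₂ (cons (hd h₁) t₃))) (fold countStep)
               ⨾ set (cons (tl (hd t₂)) (cons (hd t₃) (tl (tl h₀))))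

  -- The coloring is stored twice: one copy is consumed along the rows, the other is handed afresh
  -- to each row for its columns.
  evaluate : Command 2
  evaluate = set (cons h₀ (cons t₁ (cons t₁ (cons nil nil)))) ⨾ fold evaluateStep ⨾ set t₂

  evaluateStepTime evaluateTime : ℕ → ℕ
  evaluateStepTime n = 30 + foldTime n 50 + 17
  evaluateTime n = 13 + (foldTime n (evaluateStepTime n) + 4)

  Runs-evaluateStep : ∀ {n} (r : Fin n → Bool) c c′ m₀ m₁ → Runs evaluateStep
    (row r ∙ (colors c′ ∙ (colors c ∙ (unary m₀ ∙ unary m₁))))
    (colors (rest c′) ∙ (colors c ∙ (unary (∑ (λ w → ind (r w ∧ (not (first c′) ∧ not (at c w)))) + m₀)
                                     ∙ unary (∑ (λ w → ind (r w ∧ (first c′ ∧ at c w))) + m₁))))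
    (evaluateStepTime n)
  Runs-evaluateStep r c []       m₀ m₁ = Runs-call _ (Runs-countRow r false c m₀ m₁) then Runs-set _
  Runs-evaluateStep r c (b ∷ c′) m₀ m₁ = Runs-call _ (Runs-countRow r b c m₀ m₁) then Runs-set _

  Runs-evaluateRows : ∀ {m n} (A : Fin m → Fin n → Bool) c c′ m₀ m₁ → Runs (fold evaluateStep)
    (matrix A ∙ (colors c′ ∙ (colors c ∙ (unary m₀ ∙ unary m₁))))
    (colors (dropRest m c′) ∙ (colors c ∙ (unary (within A (not ∘ at c′) (not ∘ at c) + m₀)
                                           ∙ unary (within A (at c′) (at c) + m₁))))
    (foldTime m (evaluateStepTime n))
  Runs-evaluateRows {zero}  A c c′ m₀ m₁ = Runs-fold-nil
  Runs-evaluateRows {suc m} A c c′ m₀ m₁ = Runs-fold-cons (Runs-evaluateStep (A zero) c c′ m₀ m₁)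
    (Runs-result (cong₂ (λ k₀ k₁ → colors (dropRest m (rest c′)) ∙ (colors c ∙ (unary k₀ ∙ unary k₁)))
      (shift-sum (within (A ∘ suc) (not ∘ at (rest c′)) (not ∘ at c)) (∑ (λ w → ind (A zero w ∧ (not (first c′) ∧ not (at c w))))) m₀)
      (shift-sum (within (A ∘ suc) (at (rest c′)) (at c)) (∑ (λ w → ind (A zero w ∧ (first c′ ∧ at c w)))) m₁))
      (Runs-evaluateRows (A ∘ suc) c (rest c′) _ _))

  Runs-evaluate : ∀ {n} (A : Fin n → Fin n → Bool) c → Runs evaluate (matrix A ∙ colors c)
    (unary (within A (not ∘ at c) (not ∘ at c)) ∙ unary (within A (at c) (at c))) (evaluateTime n)
  Runs-evaluate A c = Runs-result (cong₂ (λ k₀ k₁ → unary k₀ ∙ unary k₁)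
    (ℕ.+-identityʳ (within A (not ∘ at c) (not ∘ at c))) (ℕ.+-identityʳ (within A (at c) (at c))))
    (Runs-set _ then Runs-evaluateRows A c c 0 0 then Runs-set _)

  -- Minimum, maximum and division of unary numbers.

  minimumStep maximumStep minimum maximum : Command 2
  minimumStep = ifᶜ h₁ then set (cons (tl h₁) (cons nil t₂)) else set t₁
  maximumStep = ifᶜ h₁ then set (cons (tl h₁) t₂) else set (cons h₁ (cons nil t₂))
  minimum = set (cons h₀ (cons t₁ nil)) ⨾ fold minimumStep ⨾ set t₁
  maximum = set (cons h₀ (cons t₁ t₁)) ⨾ fold maximumStep ⨾ set t₁

  minimumTime maximumTime : ℕ → ℕ
  minimumTime k = 8 + (foldTime k 20 + 3)
  maximumTime k = 9 + (foldTime k 20 + 3)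

  Runs-minimumFold : ∀ a b o → Runs (fold minimumStep) (unary a ∙ (unary b ∙ unary o))
    (unary (b ∸ a) ∙ unary (a ⊓ b + o)) (foldTime a 20)
  Runs-minimumFold zero    b       o = Runs-fold-nil
  Runs-minimumFold (suc a) zero    o = Runs-fold-cons {a′ = nil ∙ unary o} {t = 20}
    (Runs-≤ (ℕ.≤ᵇ⇒≤ _ _ _) (Runs-false h₁ refl (Runs-set _)))
    (Runs-result (cong₂ (λ k l → unary k ∙ unary (l + o)) (ℕ.0∸n≡0 a) (ℕ.⊓-zeroʳ a)) (Runs-minimumFold a zero o))
  Runs-minimumFold (suc a) (suc b) o = Runs-fold-cons {t = 20}
    (Runs-≤ (ℕ.≤ᵇ⇒≤ _ _ _) (Runs-true h₁ refl (Runs-set _)))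
    (Runs-result (cong (λ l → unary (b ∸ a) ∙ unary l) (ℕ.+-suc (a ⊓ b) o)) (Runs-minimumFold a b (suc o)))

  Runs-minimum : ∀ {k} a b → a ≤ k → Runs minimum (unary a ∙ unary b) (unary (a ⊓ b)) (minimumTime k)
  Runs-minimum a b a≤k = Runs-≤ (ℕ.+-monoʳ-≤ 8 (ℕ.+-monoˡ-≤ 3 (foldTime-mono 20 a≤k)))
    (Runs-result (cong unary (ℕ.+-identityʳ (a ⊓ b)))
      (Runs-set _ then Runs-minimumFold a b 0 then Runs-set _))

  -- The rounds after `b` is exhausted are counted. `maximum` starts the counter at `b`, and
  -- `a ∸ b + b` is the maximum.
  Runs-maximumFold : ∀ a b o → Runs (fold maximumStep) (unary a ∙ (unary b ∙ unary o))
    (unary (b ∸ a) ∙ unary (a ∸ b + o)) (foldTime a 20)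
  Runs-maximumFold zero    zero    o = Runs-fold-nil
  Runs-maximumFold zero    (suc b) o = Runs-fold-nil
  Runs-maximumFold (suc a) zero    o = Runs-fold-cons {t = 20}
    (Runs-≤ (ℕ.≤ᵇ⇒≤ _ _ _) (Runs-false h₁ refl (Runs-set _)))
    (Runs-result (cong₂ (λ k l → unary k ∙ unary l) (ℕ.0∸n≡0 a) (ℕ.+-suc a o)) (Runs-maximumFold a zero (suc o)))
  Runs-maximumFold (suc a) (suc b) o = Runs-fold-cons {t = 20}
    (Runs-≤ (ℕ.≤ᵇ⇒≤ _ _ _) (Runs-true h₁ refl (Runs-set _)))
    (Runs-maximumFold a b o)

  Runs-maximum : ∀ {k} a b → a ≤ k → Runs maximum (unary a ∙ unary b) (unary (a ⊔ b)) (maximumTime k)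
  Runs-maximum a b a≤k = Runs-≤ (ℕ.+-monoʳ-≤ 9 (ℕ.+-monoˡ-≤ 3 (foldTime-mono 20 a≤k)))
    (Runs-result (cong unary (max a b))
      (Runs-set _ then Runs-maximumFold a b b then Runs-set _))
    where
    max : ∀ a b → a ∸ b + b ≡ a ⊔ b
    max zero    zero    = refl
    max zero    (suc b) = refl
    max (suc a) zero    = cong suc (ℕ.+-identityʳ a)
    max (suc a) (suc b) = trans (ℕ.+-suc (a ∸ b) b) (cong suc (max a b))

  tails : ℕ → Expression 1 → Expression 1
  tails zero    e = e
  tails (suc c) e = tails c (tl e)

  value-tails : ∀ c e x n → value e x ≡ unary n → value (tails c e) x ≡ unary (n ∸ c)
  value-tails zero    e x n       eq = eq
  value-tails (suc c) e x zero    eq = trans (value-tails c (tl e) x zero (cong tail eq)) (cong unary (ℕ.0∸n≡0 c))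
  value-tails (suc c) e x (suc n) eq = value-tails c (tl e) x n (cong tail eq)

  cost-tails : ∀ c e → cost (tails c e) ≡ c + cost e
  cost-tails zero    e = refl
  cost-tails (suc c) e = trans (cost-tails c (tl e)) (ℕ.+-suc c (cost e))

  divideBody divide : ℕ → Command 2
  divideBody c = set (cons (tails c h₀) (cons nil t₁))
  divide c = set (cons ⋆ nil) ⨾ (while embed h₀ loop divideBody c) ⨾ set t₁

  -- For positive `c` this is ⌈n / c⌉, given by its universal property, the form in which the
  -- correctness proof uses it.
  IsCeiling : ℕ → ℕ → ℕ → Set
  IsCeiling c n q = n ≤ c * q × (∀ l → n ≤ c * l → q ≤ l)

  divideLoopTime divideTime : ℕ → ℕ → ℕ
  divideLoopTime c zero    = 3
  divideLoopTime c (suc k) = 3 + suc (cost (cons (tails (suc c) h₀) (cons nil t₁))) + divideLoopTime c k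
  divideTime c k = 4 + (divideLoopTime c k + 3)

  -- Removing a batch stops at 0, so an incomplete last batch still counts as one; this is the
  -- rounding up.
  Runs-divideLoop : ∀ c k n o → n ≤ k → ∃[ q ] IsCeiling (suc c) n q ×
    Runs (while embed h₀ loop divideBody (suc c)) (unary n ∙ unary o) (nil ∙ unary (q + o)) (divideLoopTime c k)
  Runs-divideLoop c k zero o _ = 0 , (z≤n , λ _ _ → z≤n) , Runs-≤ (base k) (Runs-while-false h₀ refl)
    where
    base : ∀ k → 3 ≤ divideLoopTime c k
    base zero    = ℕ.≤-refl
    base (suc k) = ℕ.≤-trans (base k) (ℕ.m≤n+m (divideLoopTime c k) _)
  Runs-divideLoop c (suc k) (suc n) o (s≤s n≤k)
    with Runs-divideLoop c k (n ∸ c) (suc o) (ℕ.≤-trans (ℕ.m∸n≤m n c) n≤k)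
  ... | q , (lower , least) , r = suc q , (lower′ , least′) , Runs-while-true h₀ refl
      (Runs-result (cong (_∙ unary (suc o)) (value-tails (suc c) h₀ (unary (suc n) ∙ unary o) (suc n) refl))
        (Runs-set (cons (tails (suc c) h₀) (cons nil t₁))))
      (Runs-result (cong (λ l → nil ∙ unary l) (ℕ.+-suc q o)) r)
    where
    lower′ : suc n ≤ suc c * suc q
    lower′ = begin
      suc n                  ≤⟨ s≤s (ℕ.m≤n+m∸n n c) ⟩
      suc c + (n ∸ c)        ≤⟨ ℕ.+-monoʳ-≤ (suc c) lower ⟩
      suc c + suc c * q      ≡⟨ sym (ℕ.*-suc (suc c) q) ⟩
      suc c * suc q          ∎
      where open ℕ.≤-Reasoning
    least′ : ∀ l → suc n ≤ suc c * l → suc q ≤ l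
    least′ zero    h = contradiction (subst (suc n ≤_) (ℕ.*-zeroʳ (suc c)) h) λ ()
    least′ (suc l) h = s≤s (least l (begin
      suc n ∸ suc c                ≤⟨ ℕ.∸-monoˡ-≤ (suc c) h ⟩
      suc c * suc l ∸ suc c        ≡⟨ cong (_∸ suc c) (ℕ.*-suc (suc c) l) ⟩
      suc c + suc c * l ∸ suc c    ≡⟨ ℕ.m+n∸m≡n (suc c) (suc c * l) ⟩
      suc c * l                    ∎))
      where open ℕ.≤-Reasoning

  Runs-divide : ∀ c {k} n → n ≤ k → ∃[ q ] IsCeiling (suc c) n q ×
    Runs (divide (suc c)) (unary n) (unary q) (divideTime c k)
  Runs-divide c {k} n n≤k with Runs-divideLoop c k n 0 n≤k
  ... | q , ceiling , r = q , ceiling ,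
    (Runs-set (cons ⋆ nil) then Runs-result (cong (λ l → nil ∙ unary l) (ℕ.+-identityʳ q)) r then Runs-set t₁)

  -- The branch for graphs with many edges.

  count₀ count₁ : ∀ {n} → (Fin n → Fin n → Bool) → List Bool → ℕ
  count₀ A c = within A (not ∘ at c) (not ∘ at c)
  count₁ A c = within A (at c) (at c)

  -- `formula` starts from the coloring in which only vertex 0 is `true`. Each `false` put in front
  -- moves the `true` to the next vertex, and folding over the rows gives one round per vertex; the
  -- class of `false` is then the set of all other vertices.
  othersStep : Command 2
  othersStep = call (cons h₂ h₁) evaluate
             ⨾ call (cons t₄ (hd h₀)) minimum
             ⨾ set (cons (cons nil h₃) (cons h₄ h₀))

  -- All numbers here count ordered pairs, so the divisors are 2 and 16 in place of 1 and 8.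
  formula : Command 2
  formula = call (cons h₀ (cons (cons (cons nil nil) nil) (cons h₀ t₁))) (fold othersStep)
          ⨾ call (tl (tl h₀)) (divide 2)
          ⨾ call t₃ (divide 16)
          ⨾ set (cons h₁ h₀)
          ⨾ minimum

  falses : ℕ → List Bool → List Bool
  falses zero    c = c
  falses (suc k) c = falses k (false ∷ c)

  othersTime formulaTime : ℕ → ℕ → ℕ
  othersTime n N = (21 + evaluateTime n) + ((22 + minimumTime N) + 18)
  formulaTime n N = (27 + foldTime n (othersTime n N)) + ((17 + divideTime 1 N) + ((17 + divideTime 15 N) + (7 + minimumTime N)))

  module _ {n : ℕ} (A : Fin n → Fin n → Bool) where

    leastOthers : ℕ → List Bool → ℕ → ℕ
    leastOthers zero    c m = m
    leastOthers (suc k) c m = leastOthers k (false ∷ c) (m ⊓ count₀ A c)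

    Runs-othersStep : ∀ {N h} c m → m ≤ N → Runs othersStep
      (h ∙ (colors c ∙ (matrix A ∙ unary m)))
      (colors (false ∷ c) ∙ (matrix A ∙ unary (m ⊓ count₀ A c))) (othersTime n N)
    Runs-othersStep c m m≤N = Runs-call _ (Runs-evaluate A c)
      then Runs-call _ (Runs-minimum m (count₀ A c) m≤N) then Runs-set _

    Runs-others : ∀ {N k} (h : Fin k → Tree) c m → m ≤ N → Runs (fold othersStep)
      (list (tabulate h) ∙ (colors c ∙ (matrix A ∙ unary m)))
      (colors (falses k c) ∙ (matrix A ∙ unary (leastOthers k c m))) (foldTime k (othersTime n N))
    Runs-others {k = zero}  h c m m≤N = Runs-fold-nil
    Runs-others {k = suc k} h c m m≤N = Runs-fold-cons (Runs-othersStep c m m≤N)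
      (Runs-others (h ∘ suc) (false ∷ c) (m ⊓ count₀ A c) (ℕ.≤-trans (ℕ.m⊓n≤m m _) m≤N))

    leastOthers≤ : ∀ k c m → leastOthers k c m ≤ m
    leastOthers≤ zero    c m = ℕ.≤-refl
    leastOthers≤ (suc k) c m = ℕ.≤-trans (leastOthers≤ k (false ∷ c) _) (ℕ.m⊓n≤m m _)

    Runs-formula : ∀ {N} m → m ≤ N → ∃[ q ] ∃[ k ] IsCeiling 2 (leastOthers n (true ∷ []) m) q × IsCeiling 16 m k ×
      Runs formula (matrix A ∙ unary m) (unary (q ⊓ k)) (formulaTime n N)
    Runs-formula {N} m m≤N = conclude (Runs-divide 1 least least≤N) (Runs-divide 15 m m≤N)
      where
      least : ℕ
      least = leastOthers n (true ∷ []) m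
      least≤N : least ≤ N
      least≤N = ℕ.≤-trans (leastOthers≤ n (true ∷ []) m) m≤N
      conclude : (∃[ q ] IsCeiling 2 least q × Runs (divide 2) (unary least) (unary q) (divideTime 1 N)) →
                 (∃[ k ] IsCeiling 16 m k × Runs (divide 16) (unary m) (unary k) (divideTime 15 N)) →
                 ∃[ q ] ∃[ k ] IsCeiling 2 least q × IsCeiling 16 m k ×
                   Runs formula (matrix A ∙ unary m) (unary (q ⊓ k)) (formulaTime n N)
      conclude (q , ceiling₂ , r₂) (k , ceiling₁₆ , r₁₆) = q , k , ceiling₂ , ceiling₁₆ ,
        (Runs-call _ (Runs-others (row ∘ A) (true ∷ []) m m≤N) then Runs-call _ r₂ then Runs-call _ r₁₆ then Runs-set _
         -- `q ≤ least` by minimality of the ceiling, since `least ≤ 2 * least`.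
         then Runs-minimum q k (ℕ.≤-trans (proj₂ ceiling₂ least (ℕ.m≤m+n least _)) least≤N))

  -- Exhaustive search, for graphs with few edges.

  someStep flagStep : Command 2
  someStep = ifᶜ h₀ then set (cons nil nil) else set t₁
  flagStep = call (cons h₀ nil) (fold someStep) ⨾ set (cons h₀ t₂)

  some : ∀ {n} → (Fin n → Bool) → Bool → Bool
  some {zero}  r b = b
  some {suc n} r b = some (r ∘ suc) (r zero ∨ b)

  Runs-someStep : ∀ a b → Runs someStep (bit a ∙ bit b) (bit (a ∨ b)) 10
  Runs-someStep false b = Runs-≤ (ℕ.≤ᵇ⇒≤ _ _ _) (Runs-false h₀ refl (Runs-set _))
  Runs-someStep true  b = Runs-≤ (ℕ.≤ᵇ⇒≤ _ _ _) (Runs-true h₀ refl (Runs-set _))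

  Runs-some : ∀ {n} (r : Fin n → Bool) b → Runs (fold someStep) (row r ∙ bit b) (bit (some r b)) (foldTime n 10)
  Runs-some {zero}  r b = Runs-fold-nil
  Runs-some {suc n} r b = Runs-fold-cons (Runs-someStep (r zero) b) (Runs-some (r ∘ suc) (r zero ∨ b))

  -- Marks the vertices that are not isolated; only these receive both colors in the search.
  flag : ∀ {m n} → (Fin m → Fin n → Bool) → Fin m → Bool
  flag A u = some (A u) false

  flagTime : ℕ → ℕ
  flagTime n = (17 + foldTime n 10) + 7

  Runs-flags : ∀ {m n} (A : Fin m → Fin n → Bool) ys → Runs (fold flagStep)
    (matrix A ∙ list ys) (list (tabulate (bit ∘ flag A) ʳ++ ys)) (foldTime m (flagTime n))
  Runs-flags {zero}  A ys = Runs-fold-nil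
  Runs-flags {suc m} A ys = Runs-fold-cons (Runs-call _ (Runs-some (A zero) false) then Runs-set _)
    (Runs-flags (A ∘ suc) (bit (flag A zero) ∷ ys))

  oneStep twoStep grow : Command 2
  oneStep = set (cons (cons nil h₀) t₁)
  twoStep = set (cons (cons nil h₀) (cons (cons (cons nil nil) h₀) t₁))
  grow = ifᶜ h₀ then (set (cons t₁ nil) ⨾ fold twoStep) else (set (cons t₁ nil) ⨾ fold oneStep)

  colorings : List (List Bool) → Tree
  colorings cs = list (map colors cs)

  onto₁ onto₂ : List (List Bool) → List (List Bool) → List (List Bool)
  onto₁ []       ds = ds
  onto₁ (c ∷ cs) ds = onto₁ cs ((false ∷ c) ∷ ds)
  onto₂ []       ds = ds
  onto₂ (c ∷ cs) ds = onto₂ cs ((false ∷ c) ∷ (true ∷ c) ∷ ds)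

  grown : Bool → List (List Bool) → List (List Bool)
  grown false cs = onto₁ cs []
  grown true  cs = onto₂ cs []

  Runs-onto₁ : ∀ cs ds → Runs (fold oneStep) (colorings cs ∙ colorings ds) (colorings (onto₁ cs ds)) (foldTime (length cs) 20)
  Runs-onto₁ []       ds = Runs-fold-nil
  Runs-onto₁ (c ∷ cs) ds = Runs-fold-cons {t = 20} (Runs-≤ (ℕ.≤ᵇ⇒≤ _ _ _) (Runs-set _)) (Runs-onto₁ cs ((false ∷ c) ∷ ds))

  Runs-onto₂ : ∀ cs ds → Runs (fold twoStep) (colorings cs ∙ colorings ds) (colorings (onto₂ cs ds)) (foldTime (length cs) 20)
  Runs-onto₂ []       ds = Runs-fold-nil
  Runs-onto₂ (c ∷ cs) ds = Runs-fold-cons {t = 20} (Runs-≤ (ℕ.≤ᵇ⇒≤ _ _ _) (Runs-set _)) (Runs-onto₂ cs ((false ∷ c) ∷ (true ∷ c) ∷ ds))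

  growTime : ℕ → ℕ
  growTime k = 8 + foldTime k 20

  Runs-grow : ∀ {k} b cs → length cs ≤ k → Runs grow (bit b ∙ colorings cs) (colorings (grown b cs)) (growTime k)
  Runs-grow false cs le = Runs-≤ (ℕ.+-monoʳ-≤ 8 (foldTime-mono 20 le)) (Runs-false h₀ refl (Runs-set _ then Runs-onto₁ cs []))
  Runs-grow true  cs le = Runs-≤ (ℕ.+-monoʳ-≤ 8 (foldTime-mono 20 le)) (Runs-true h₀ refl (Runs-set _ then Runs-onto₂ cs []))

  candidates : ∀ {n} → (Fin n → Bool) → List (List Bool)
  candidates {zero}  f = [] ∷ []
  candidates {suc n} f = grown (f zero) (candidates (f ∘ suc))

  length-onto₁ : ∀ cs ds → length (onto₁ cs ds) ≡ length cs + length ds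
  length-onto₁ []       ds = refl
  length-onto₁ (c ∷ cs) ds = trans (length-onto₁ cs _) (ℕ.+-suc (length cs) (length ds))

  length-onto₂ : ∀ cs ds → length (onto₂ cs ds) ≡ 2 * length cs + length ds
  length-onto₂ []       ds = refl
  length-onto₂ (c ∷ cs) ds = trans (length-onto₂ cs _) (step (length cs) (length ds))
    where
    step : ∀ a b → 2 * a + (2 + b) ≡ 2 * (1 + a) + b
    step = solve-∀

  -- The list doubles at flagged vertices only, so its length is bounded in terms of the number of
  -- edges, whatever the order of the graph.
  length-candidates : ∀ {n} (f : Fin n → Bool) → length (candidates f) ≡ 2 ^ ∑ (ind ∘ f)
  length-candidates {zero}  f = refl
  length-candidates {suc n} f with f zero
  ... | false = trans (length-onto₁ (candidates (f ∘ suc)) []) (trans (ℕ.+-identityʳ _) (length-candidates (f ∘ suc)))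
  ... | true  = trans (length-onto₂ (candidates (f ∘ suc)) []) (trans (ℕ.+-identityʳ _) (cong (2 *_) (length-candidates (f ∘ suc))))

  -- The flags are processed from the last to the first, so that a coloring is
  -- extended at its head.
  Runs-candidates : ∀ {n j k} (f : Fin n → Bool) ys {z} → 2 ^ ∑ (ind ∘ f) ≤ k →
    Runs (fold grow) (list ys ∙ colorings (candidates f)) z (foldTime j (growTime k)) →
    Runs (fold grow) (list (tabulate (bit ∘ f) ʳ++ ys) ∙ colorings ([] ∷ [])) z (foldTime (n + j) (growTime k))
  Runs-candidates {zero}          f ys le r = r
  Runs-candidates {suc n} {j} {k} f ys {z} le r =
    -- `r` is the part of the run that treats the flags in `ys`. The induction moves the flag of
    -- vertex 0 from `f` to the front of `ys` and puts its round in front of `r`.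
    subst (λ l → Runs (fold grow) (list (tabulate (bit ∘ f) ʳ++ ys) ∙ colorings ([] ∷ [])) z (foldTime l (growTime k)))
      (ℕ.+-suc n j)
      (Runs-candidates (f ∘ suc) (bit (f zero) ∷ ys) le′
        (Runs-fold-cons (Runs-grow (f zero) (candidates (f ∘ suc))
          (ℕ.≤-trans (ℕ.≤-reflexive (length-candidates (f ∘ suc))) le′)) r))
    where
    le′ : 2 ^ ∑ (ind ∘ f ∘ suc) ≤ k
    le′ = ℕ.≤-trans (ℕ.^-monoʳ-≤ 2 (ℕ.m≤n+m (∑ (ind ∘ f ∘ suc)) (ind (f zero)))) le

  bestStep brute : Command 2
  bestStep = call (cons h₁ h₀) evaluate
           ⨾ call h₀ minimum
           ⨾ call (cons h₀ t₄) maximum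
           ⨾ set (cons h₄ h₀)
  brute = call (cons ⋆ nil) (fold flagStep)
        ⨾ call (cons h₀ (cons nil nil)) (fold grow)
        ⨾ set (cons h₀ (cons t₂ nil))
        ⨾ fold bestStep
        ⨾ set t₁
        ⨾ divide 2

  bestTime : ℕ → ℕ → ℕ
  bestTime n N = (19 + evaluateTime n) + ((15 + minimumTime N) + ((21 + maximumTime N) + 10))

  bruteTime : ℕ → ℕ → ℕ → ℕ
  bruteTime n N k = (16 + foldTime n (flagTime n)) + ((19 + foldTime (n + 0) (growTime k))
    + (9 + (foldTime k (bestTime n N) + (3 + divideTime 1 N))))

  module _ {n : ℕ} (A : Fin n → Fin n → Bool) where

    best : List (List Bool) → ℕ → ℕ
    best []       m = m
    best (c ∷ cs) m = best cs ((count₀ A c ⊓ count₁ A c) ⊔ m)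

    Runs-best : ∀ {N} → (∀ c → count₀ A c ≤ N) → ∀ cs m → Runs (fold bestStep)
      (colorings cs ∙ (matrix A ∙ unary m)) (matrix A ∙ unary (best cs m)) (foldTime (length cs) (bestTime n N))
    Runs-best small []       m = Runs-fold-nil
    Runs-best small (c ∷ cs) m = Runs-fold-cons
      (Runs-call _ (Runs-evaluate A c)
       then Runs-call h₀ (Runs-minimum (count₀ A c) (count₁ A c) (small c))
       then Runs-call (cons h₀ t₄) (Runs-maximum (count₀ A c ⊓ count₁ A c) m (ℕ.≤-trans (ℕ.m⊓n≤m _ _) (small c)))
       then Runs-set _)
      (Runs-best small cs _)

    Runs-brute : ∀ {N k} → (∀ c → count₀ A c ≤ N) → 2 ^ ∑ (ind ∘ flag A) ≤ k → best (candidates (flag A)) 0 ≤ N →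
      ∃[ q ] IsCeiling 2 (best (candidates (flag A)) 0) q × Runs brute (matrix A) (unary q) (bruteTime n N k)
    Runs-brute {N} {k} small le best≤N = conclude (Runs-divide 1 (best (candidates (flag A)) 0) best≤N)
      where
      conclude : ∃[ q ] IsCeiling 2 (best (candidates (flag A)) 0) q
                   × Runs (divide 2) (unary (best (candidates (flag A)) 0)) (unary q) (divideTime 1 N) →
                 ∃[ q ] IsCeiling 2 (best (candidates (flag A)) 0) q × Runs brute (matrix A) (unary q) (bruteTime n N k)
      conclude (q , ceiling , r) = q , ceiling ,
        (Runs-call (cons ⋆ nil) (Runs-flags A [])
         then Runs-call (cons h₀ (cons nil nil)) (Runs-candidates (flag A) [] le Runs-fold-nil)
         then Runs-set (cons h₀ (cons t₂ nil))
         then Runs-≤ (foldTime-mono _ (ℕ.≤-trans (ℕ.≤-reflexive (length-candidates (flag A))) le)) (Runs-best small (candidates (flag A)) 0)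
         then Runs-set t₁ then r)

  -- The empty coloring is `false` everywhere, so its first count is the number of all ordered pairs
  -- of adjacent vertices; `tails B` tests whether this exceeds `B`.
  main : ℕ → Command 2
  main B = call (cons ⋆ nil) evaluate
         ⨾ set (cons t₁ (hd h₀))
         ⨾ (ifᶜ tails B t₁ then formula else (set h₀ ⨾ brute))

-- Approximation ratio and polynomial running time.

module Approximation where
  open EdgeCounting
  open BalancedColoring using (LCP-balanced; twiceEdges-even)
  open Machine
  open import Data.Integer.Base as ℤ using (+_; +≤+)
  open import Data.Rational.Base using (0ℚ)
  open import Data.Rational.Unnormalised.Base as ℚᵘ using (mkℚᵘ; *≤*)
  open import Data.Nat.Base using (_+_; _*_; _∸_; _^_; _⊓_; _⊔_; _≤_; _<_)
  open import Data.Nat.Tactic.RingSolver using (solve-∀)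
  open import Algebra.Properties.Semiring.Sum ℕ.+-*-semiring as Σℕ using () renaming (sum to ∑)

  encode≡matrix : ∀ G → encode G ≡ matrix (Graph.adj G)
  encode≡matrix G = cong list (trans (List.map-tabulate (λ u → u) _)
    (List.tabulate-cong λ u → cong list (List.map-tabulate (λ v → v) (λ v → bit (adj u v)))))
    where open Graph G

  size-list : ∀ {n} (x : Fin n → Tree) → suc n ≤ size (list (tabulate x))
  size-list {zero}  x = ℕ.≤-refl
  size-list {suc n} x = s≤s (ℕ.≤-trans (size-list (x ∘ suc)) (ℕ.m≤n+m _ (size (x zero))))

  ∑-bounded : ∀ {n k} (f : Fin n → ℕ) → (∀ i → f i ≤ k) → ∑ f ≤ n * k
  ∑-bounded {zero}  f h = z≤n
  ∑-bounded {suc n} f h = ℕ.+-mono-≤ (h zero) (∑-bounded (f ∘ suc) (h ∘ suc))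

  ind≤1 : ∀ b → ind b ≤ 1
  ind≤1 true  = ℕ.≤-refl
  ind≤1 false = z≤n

  within≤n² : ∀ {n} (A : Fin n → Fin n → Bool) χ ρ → within A χ ρ ≤ n * n
  within≤n² {n} A χ ρ = ∑-bounded {n} {n} (λ u → ∑ (λ w → ind (A u w ∧ (χ u ∧ ρ w)))) λ u → ℕ.≤-trans
    (∑-bounded {n} {1} (λ w → ind (A u w ∧ (χ u ∧ ρ w))) (λ w → ind≤1 (A u w ∧ (χ u ∧ ρ w))))
    (ℕ.≤-reflexive (ℕ.*-identityʳ n))

  at-[] : ∀ {n} (v : Fin n) → at [] v ≡ false
  at-[] zero    = refl
  at-[] (suc v) = at-[] v

  count₀-[] : ∀ {n} (A : Fin n → Fin n → Bool) → count₀ A [] ≡ within A all all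
  count₀-[] A = within-cong A (cong not ∘ at-[]) (cong not ∘ at-[])

  falses-∷ : ∀ k c → falses k (false ∷ c) ≡ false ∷ falses k c
  falses-∷ zero    c = refl
  falses-∷ (suc k) c = falses-∷ k (false ∷ c)

  at-falses : ∀ {n} (v w : Fin n) → at (falses (toℕ v) (true ∷ [])) w ≡ does (w Fin.≟ v)
  at-falses zero    zero    = refl
  at-falses zero    (suc w) = at-[] w
  at-falses (suc v) zero    rewrite falses-∷ (toℕ v) (true ∷ []) = refl
  at-falses (suc v) (suc w) rewrite falses-∷ (toℕ v) (true ∷ []) = at-falses v w

  module _ {n : ℕ} (A : Fin n → Fin n → Bool) where

    leastOthers≤count₀ : ∀ {k} c m (v : Fin k) → leastOthers A k c m ≤ count₀ A (falses (toℕ v) c)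
    leastOthers≤count₀ {suc k} c m zero    = ℕ.≤-trans (leastOthers≤ A k _ _) (ℕ.m⊓n≤n m _)
    leastOthers≤count₀ {suc k} c m (suc v) = leastOthers≤count₀ (false ∷ c) _ v

    leastOthers-glb : ∀ {j} k c m → j ≤ m → (∀ (v : Fin k) → j ≤ count₀ A (falses (toℕ v) c)) → j ≤ leastOthers A k c m
    leastOthers-glb zero    c m j≤m h = j≤m
    leastOthers-glb (suc k) c m j≤m h = leastOthers-glb k (false ∷ c) _ (ℕ.⊓-glb j≤m (h zero)) (h ∘ suc)

    m≤best : ∀ cs m → m ≤ best A cs m
    m≤best []       m = ℕ.≤-refl
    m≤best (c ∷ cs) m = ℕ.≤-trans (ℕ.m≤n⊔m _ m) (m≤best cs _)

    best-upper : ∀ {c} cs m → c ∈ cs → count₀ A c ⊓ count₁ A c ≤ best A cs m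
    best-upper (c ∷ cs) m (here refl) = ℕ.≤-trans (ℕ.m≤m⊔n _ m) (m≤best cs _)
    best-upper (c ∷ cs) m (there c∈)  = best-upper cs _ c∈

    best-attained : ∀ cs m → (∃[ c ] m ≤ count₀ A c × m ≤ count₁ A c) →
      ∃[ c ] best A cs m ≤ count₀ A c × best A cs m ≤ count₁ A c
    best-attained []       m h = h
    best-attained (c ∷ cs) m (c′ , h₀ , h₁) = best-attained cs _ (case (ℕ.⊔-sel (count₀ A c ⊓ count₁ A c) m))
      where
      case : _ → ∃[ d ] (count₀ A c ⊓ count₁ A c) ⊔ m ≤ count₀ A d × (count₀ A c ⊓ count₁ A c) ⊔ m ≤ count₁ A d
      case (inj₁ eq) = c , subst (_≤ count₀ A c) (sym eq) (ℕ.m⊓n≤m _ _) , subst (_≤ count₁ A c) (sym eq) (ℕ.m⊓n≤n (count₀ A c) _)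
      case (inj₂ eq) = c′ , subst (_≤ count₀ A c′) (sym eq) h₀ , subst (_≤ count₁ A c′) (sym eq) h₁

  some-here : ∀ {n} (r : Fin n → Bool) → some r true ≡ true
  some-here {zero}  r = refl
  some-here {suc n} r rewrite Bool.∨-zeroʳ (r zero) = some-here (r ∘ suc)

  some-true : ∀ {n} (r : Fin n → Bool) b w → r w ≡ true → some r b ≡ true
  some-true r b zero    rw rewrite rw = some-here (r ∘ suc)
  some-true r b (suc w) rw = some-true (r ∘ suc) (r zero ∨ b) w rw

  ind-some : ∀ {n} (r : Fin n → Bool) b → ind (some r b) ≤ ∑ (ind ∘ r) + ind b
  ind-some {zero}  r b = ℕ.≤-refl
  ind-some {suc n} r b = ℕ.≤-trans (ind-some (r ∘ suc) (r zero ∨ b))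
    (ℕ.≤-trans (ℕ.+-monoʳ-≤ (∑ (ind ∘ r ∘ suc)) (or (r zero) b))
               (ℕ.≤-reflexive (shift-sum (∑ (ind ∘ r ∘ suc)) (ind (r zero)) (ind b))))
    where
    or : ∀ a b → ind (a ∨ b) ≤ ind a + ind b
    or false b = ℕ.≤-refl
    or true  b = s≤s z≤n

  ∈-onto₁-rest : ∀ {d} cs ds → d ∈ ds → d ∈ onto₁ cs ds
  ∈-onto₁-rest []       ds d∈ = d∈
  ∈-onto₁-rest (c ∷ cs) ds d∈ = ∈-onto₁-rest cs _ (there d∈)

  ∈-onto₂-rest : ∀ {d} cs ds → d ∈ ds → d ∈ onto₂ cs ds
  ∈-onto₂-rest []       ds d∈ = d∈
  ∈-onto₂-rest (c ∷ cs) ds d∈ = ∈-onto₂-rest cs _ (there (there d∈))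

  ∈-onto₁ : ∀ {c} cs ds → c ∈ cs → false ∷ c ∈ onto₁ cs ds
  ∈-onto₁ (c ∷ cs) ds (here refl) = ∈-onto₁-rest cs _ (here refl)
  ∈-onto₁ (c ∷ cs) ds (there c∈)  = ∈-onto₁ cs _ c∈

  ∈-onto₂ : ∀ {c} b cs ds → c ∈ cs → b ∷ c ∈ onto₂ cs ds
  ∈-onto₂ false (c ∷ cs) ds (here refl) = ∈-onto₂-rest cs _ (here refl)
  ∈-onto₂ true  (c ∷ cs) ds (here refl) = ∈-onto₂-rest cs _ (there (here refl))
  ∈-onto₂ b     (c ∷ cs) ds (there c∈)  = ∈-onto₂ b cs _ c∈

  candidate : ∀ {n} (f χ : Fin n → Bool) → ∃[ c ] c ∈ candidates f × (∀ v → f v ≡ true → at c v ≡ χ v)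
  candidate {zero}  f χ = [] , here refl , λ ()
  candidate {suc n} f χ with candidate (f ∘ suc) (χ ∘ suc) | f zero in eq
  ... | c , c∈ , agrees | true  = χ zero ∷ c , ∈-onto₂ (χ zero) _ [] c∈ , λ where
    zero    _ → refl
    (suc v) → agrees v
  ... | c , c∈ , agrees | false = false ∷ c , ∈-onto₁ _ [] c∈ , λ where
    zero    fv → contradiction (trans (sym fv) eq) λ ()
    (suc v) → agrees v

  module _ (G : Graph) where
    open Graph G using (order; adj; symmetric; irreflexive)

    private
      m : ℕ
      m = twiceEdges G all

    count₀-others : ∀ v → count₀ adj (falses (toℕ v) (true ∷ [])) ≡ twiceEdges G (others G v)
    count₀-others v = within-cong adj (cong not ∘ at-falses v) (cong not ∘ at-falses v)

    -- Both ends of an edge have a neighbor, the second one by symmetry, so the colors of isolated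
    -- vertices do not affect the count.
    within-flagged : ∀ {χ ρ} → (∀ v → flag adj v ≡ true → χ v ≡ ρ v) → twiceEdges G χ ≡ twiceEdges G ρ
    within-flagged {χ} {ρ} h = Σℕ.sum-cong-≗ λ u → Σℕ.sum-cong-≗ λ w → entry u w
      where
      entry : ∀ u w → ind (adj u w ∧ (χ u ∧ χ w)) ≡ ind (adj u w ∧ (ρ u ∧ ρ w))
      entry u w with adj u w in eq
      ... | false = refl
      ... | true  = cong₂ (λ a b → ind (a ∧ b)) (h u (some-true (adj u) false w eq))
                                             (h w (some-true (adj w) false u (trans (symmetric w u) eq)))

    -- A flagged vertex has degree at least 1.
    flags≤m : ∑ (ind ∘ flag adj) ≤ m
    flags≤m = ∑-mono-≤ λ u → ℕ.≤-trans (ind-some (adj u) false) (ℕ.≤-reflexive (trans (ℕ.+-identityʳ _)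
      (Σℕ.sum-cong-≗ λ w → cong ind (sym (Bool.∧-identityʳ (adj u w))))))

    LCP-antitone : ∀ {j k} → j ≤ k → G ∈[2, k ]-LCP → G ∈[2, j ]-LCP
    LCP-antitone j≤k (φ , h) = φ , ℕ.≤-trans j≤k ∘ h

    k-opt-LCP : G ∈[2, k-opt G ]-LCP
    k-opt-LCP = proj₁ (proj₂ (optimum-exists G))

    -- `twiceEdges` is even, so a lower bound on it may be rounded up to the next even number.
    ceiling-half : ∀ {x q} χ → IsCeiling 2 x q → x ≤ twiceEdges G χ → 2 * q ≤ twiceEdges G χ
    ceiling-half {x} {q} χ (_ , least) x≤ with twiceEdges-even G χ
    ... | l , eq = subst (2 * q ≤_) (sym eq) (ℕ.*-monoʳ-≤ 2 (least l (subst (x ≤_) eq x≤)))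

    IsApproximation : ℕ → Set
    IsApproximation k = G ∈[2, k ]-LCP × k-opt G ≤ 4 * k

    -- Some candidate agrees with an optimal coloring at all flagged vertices, so the search attains
    -- the optimum; the factor 4 is slack here.
    brute-correct : ∀ {q} → IsCeiling 2 (best adj (candidates (flag adj)) 0) q → IsApproximation q
    brute-correct {q} ceiling = lcp (best-attained adj (candidates (flag adj)) 0 ([] , z≤n , z≤n)) ,
      ℕ.≤-trans (optimal (LCP-elim G k-opt-LCP)) (ℕ.m≤m+n q _)
      where
      x : ℕ
      x = best adj (candidates (flag adj)) 0
      lcp : ∃[ c ] x ≤ count₀ adj c × x ≤ count₁ adj c → G ∈[2, q ]-LCP
      lcp (c , x≤₀ , x≤₁) = LCP-intro G (at c) (ceiling-half (at c) ceiling x≤₁) (ceiling-half (not ∘ at c) ceiling x≤₀)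
      optimal : ∃[ χ ] 2 * k-opt G ≤ twiceEdges G χ × 2 * k-opt G ≤ twiceEdges G (not ∘ χ) → k-opt G ≤ q
      optimal (χ , h₁ , h₀) with candidate (flag adj) χ
      ... | c , c∈ , agrees = ℕ.*-cancelˡ-≤ 2 (ℕ.≤-trans (ℕ.⊓-glb
          (subst (2 * k-opt G ≤_) (within-flagged λ v fv → cong not (sym (agrees v fv))) h₀)
          (subst (2 * k-opt G ≤_) (within-flagged λ v fv → sym (agrees v fv)) h₁))
          (ℕ.≤-trans (best-upper adj (candidates (flag adj)) 0 c∈) (proj₁ ceiling)))

    formula-correct : ∀ κ → κ ≡ + 64 → ∀ {B} → + 32 ℤ.* (κ ℤ.* κ) ≡ + B → B < m →
      ∀ {q k} → IsCeiling 2 (leastOthers adj order (true ∷ []) m) q → IsCeiling 16 m k → IsApproximation (q ⊓ k)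
    formula-correct κ κ≡64 {B} B≡ B<m {q} {k} ceiling₂ (m≤16k , leastk) = lcp , bound
      where
      least : ℕ
      least = leastOthers adj order (true ∷ []) m

      2q≤others : ∀ v → 2 * q ≤ twiceEdges G (others G v)
      2q≤others v = ceiling-half (others G v) ceiling₂
        (ℕ.≤-trans (leastOthers≤count₀ adj (true ∷ []) m v) (ℕ.≤-reflexive (count₀-others v)))

      -- Otherwise m ≤ 16 (k - 1), against the minimality of `k`.
      16k≤m+15 : 16 * k ≤ m + 15
      16k≤m+15 = ℕ.≮⇒≥ λ m+15<16k → impossible k leastk m+15<16k
        where
        impossible : ∀ k → (∀ l → m ≤ 16 * l → k ≤ l) → ¬ m + 15 < 16 * k
        impossible zero    _     h = contradiction (subst (m + 15 <_) (ℕ.*-zeroʳ 16) h) λ ()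
        impossible (suc k) least h = ℕ.<-irrefl refl (least k (ℕ.+-cancelʳ-≤ 16 m (16 * k)
          (subst₂ _≤_ (sym (ℕ.+-suc m 15)) (sixteen k) h)))
          where
          sixteen : ∀ k → 16 * (1 + k) ≡ 16 * k + 16
          sixteen = solve-∀

      lcp : G ∈[2, q ⊓ k ]-LCP
      lcp with Fin.any? (λ v → 3 * k ℕ.≤? degree adj v)
      ... | yes (v , 3k≤deg) = LCP-star G v (ℕ.≤-trans (ℕ.*-monoʳ-≤ 3 (ℕ.m⊓n≤n q k)) 3k≤deg)
                                 (ℕ.≤-trans (ℕ.*-monoʳ-≤ 2 (ℕ.m⊓n≤m q k)) (2q≤others v))
      ... | no small = LCP-antitone (ℕ.m⊓n≤n q k) (LCP-balanced G κ κ≡64 k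
            (λ v → ℕ.≰⇒≥ λ 3k≤deg → small (v , 3k≤deg)) (ℕ.≤-<-trans z≤n B<m) 16k≤m+15
            (subst (ℤ._≤ + m) (sym B≡) (+≤+ (ℕ.<⇒≤ B<m))))

      4*k-opt≤m : 4 * k-opt G ≤ m
      4*k-opt≤m = LCP-half G k-opt-LCP

      -- The optimum is at most `q`, with the factor 4 to spare. For `k` the factor is used up: 4
      -- times the optimum is at most `m`, and `m ≤ 16 * k`.
      bound : k-opt G ≤ 4 * (q ⊓ k)
      bound = subst (k-opt G ≤_) (sym (ℕ.*-distribˡ-⊓ 4 q k)) (ℕ.⊓-glb
        (ℕ.≤-trans (ℕ.*-cancelˡ-≤ 2 (ℕ.≤-trans
          (leastOthers-glb adj order (true ∷ []) m (ℕ.≤-trans (ℕ.*-monoˡ-≤ (k-opt G) (ℕ.m≤m+n 2 2)) 4*k-opt≤m)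
            (λ v → subst (2 * k-opt G ≤_) (sym (count₀-others v)) (LCP-others G v k-opt-LCP)))
          (proj₁ ceiling₂))) (ℕ.m≤m+n q _))
        (ℕ.*-cancelˡ-≤ 4 (ℕ.≤-trans 4*k-opt≤m (ℕ.≤-trans m≤16k (ℕ.≤-reflexive (ℕ.*-assoc 4 4 k))))))

  -- The times of both branches are added, so one expression bounds either. The constant `2 ^ B`
  -- bounds the number of candidates.
  mainTime : ℕ → ℕ → ℕ
  mainTime B n = (16 + evaluateTime n) + (7 + (suc (cost (tails B t₁))
    + (formulaTime n (n * n) + (3 + bruteTime n (n * n) (2 ^ B)))))

  -- `κ` and `B` remain variables tied to their values by equations, so that `tails B` and `2 ^ B`
  -- need not be unfolded at a large numeral.
  main-correct : ∀ κ → κ ≡ + 64 → ∀ B → + 32 ℤ.* (κ ℤ.* κ) ≡ + B → ∀ G →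
    ∃[ k ] Runs (main B) (encode G) (unary k) (mainTime B (Graph.order G)) × IsApproximation G k
  main-correct κ κ≡64 B B≡ G = finish (B ℕ.<? m)
    where
    open Graph G using (order; adj)
    m : ℕ
    m = twiceEdges G all
    counted : Tree
    counted = matrix adj ∙ unary (count₀ adj [])

    test : value (tails B t₁) counted ≡ unary (m ∸ B)
    test = trans (value-tails B t₁ counted (count₀ adj []) refl) (cong (λ x → unary (x ∸ B)) (count₀-[] adj))

    branch : Command 2
    branch = ifᶜ tails B t₁ then formula else (set h₀ ⨾ brute)

    prepend : ∀ {y t} → Runs branch counted y t → Runs (main B) (encode G) y ((16 + evaluateTime order) + (7 + t))
    prepend {y} {t} r = subst (λ x → Runs (main B) x y ((16 + evaluateTime order) + (7 + t))) (sym (encode≡matrix G))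
      (Runs-call _ (Runs-evaluate adj []) then Runs-set _ then r)

    Result : Set
    Result = ∃[ k ] Runs (main B) (encode G) (unary k) (mainTime B order) × IsApproximation G k

    positive : ∀ x → 0 < x → ∃[ l ] unary x ≡ nil ∙ l
    positive (suc x) _ = _ , refl

    viaFormula : B < m → (∃[ q ] ∃[ k ] IsCeiling 2 (leastOthers adj order (true ∷ []) m) q × IsCeiling 16 m k ×
      Runs formula (matrix adj ∙ unary m) (unary (q ⊓ k)) (formulaTime order (order * order))) → Result
    viaFormula B<m (q , k , ceiling₂ , ceiling₁₆ , r) = q ⊓ k ,
      prepend (Runs-≤ (ℕ.+-monoʳ-≤ (suc (cost (tails B t₁))) (ℕ.m≤m+n (formulaTime order (order * order)) _))
        (Runs-true (tails B t₁) (trans test (proj₂ (positive (m ∸ B) (ℕ.m<n⇒0<n∸m B<m))))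
          (subst (λ x → Runs formula (matrix adj ∙ unary x) (unary (q ⊓ k)) (formulaTime order (order * order)))
            (sym (count₀-[] adj)) r))) ,
      formula-correct G κ κ≡64 B≡ B<m ceiling₂ ceiling₁₆

    viaBrute : m ≤ B → (∃[ q ] IsCeiling 2 (best adj (candidates (flag adj)) 0) q ×
      Runs brute (matrix adj) (unary q) (bruteTime order (order * order) (2 ^ B))) → Result
    viaBrute m≤B (q , ceiling , r) = q ,
      prepend (Runs-≤ (ℕ.+-monoʳ-≤ (suc (cost (tails B t₁))) (ℕ.m≤n+m _ (formulaTime order (order * order))))
        (Runs-false (tails B t₁) (trans test (cong unary (ℕ.m≤n⇒m∸n≡0 m≤B)))
          (Runs-set h₀ then r))) ,
      brute-correct G ceiling

    finish : Dec (B < m) → Result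
    finish (yes B<m) = viaFormula B<m (Runs-formula adj m (within≤n² adj all all))
    finish (no B≮m) = viaBrute (ℕ.≮⇒≥ B≮m) (Runs-brute adj {k = 2 ^ B} (λ c → within≤n² adj (not ∘ at c) (not ∘ at c))
      (ℕ.^-monoʳ-≤ 2 (ℕ.≤-trans (flags≤m G) (ℕ.≮⇒≥ B≮m)))
      (let c , x≤ , _ = best-attained adj (candidates (flag adj)) 0 ([] , z≤n , z≤n)
       in ℕ.≤-trans x≤ (within≤n² adj (not ∘ at c) (not ∘ at c))))

  -- Polynomial bounds on the running time.

  -- The base `suc n` is positive, so exponents may be raised freely, and for `n` the order of a
  -- graph it is at most the size of the encoding.
  Polynomial : (ℕ → ℕ) → Set
  Polynomial f = ∃[ c ] ∃[ d ] ∀ n → f n ≤ c * suc n ^ d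

  polynomial-const : ∀ k → Polynomial (λ _ → k)
  polynomial-const k = k , 0 , λ _ → ℕ.≤-reflexive (sym (ℕ.*-identityʳ k))

  polynomial-id : Polynomial (λ n → n)
  polynomial-id = 1 , 1 , λ n → ℕ.≤-trans (ℕ.n≤1+n n)
    (ℕ.≤-reflexive (sym (trans (ℕ.*-identityˡ (suc n ^ 1)) (ℕ.*-identityʳ (suc n)))))

  polynomial-+ : ∀ {f g} → Polynomial f → Polynomial g → Polynomial (λ n → f n + g n)
  polynomial-+ {f} {g} (c , d , p) (c′ , d′ , p′) = c + c′ , d + d′ , λ n → begin
    f n + g n                                          ≤⟨ ℕ.+-mono-≤ (p n) (p′ n) ⟩
    c * suc n ^ d + c′ * suc n ^ d′
      ≤⟨ ℕ.+-mono-≤ (ℕ.*-monoʳ-≤ c (ℕ.^-monoʳ-≤ (suc n) (ℕ.m≤m+n d d′)))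
                    (ℕ.*-monoʳ-≤ c′ (ℕ.^-monoʳ-≤ (suc n) (ℕ.m≤n+m d′ d))) ⟩
    c * suc n ^ (d + d′) + c′ * suc n ^ (d + d′)       ≡⟨ sym (ℕ.*-distribʳ-+ (suc n ^ (d + d′)) c c′) ⟩
    (c + c′) * suc n ^ (d + d′)                        ∎
    where open ℕ.≤-Reasoning

  polynomial-* : ∀ {f g} → Polynomial f → Polynomial g → Polynomial (λ n → f n * g n)
  polynomial-* {f} {g} (c , d , p) (c′ , d′ , p′) = c * c′ , d + d′ , λ n → begin
    f n * g n                            ≤⟨ ℕ.*-mono-≤ (p n) (p′ n) ⟩
    c * suc n ^ d * (c′ * suc n ^ d′)    ≡⟨ rearrange c (suc n ^ d) c′ (suc n ^ d′) ⟩
    c * c′ * (suc n ^ d * suc n ^ d′)    ≡⟨ cong (c * c′ *_) (sym (ℕ.^-distribˡ-+-* (suc n) d d′)) ⟩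
    c * c′ * suc n ^ (d + d′)            ∎
    where
    open ℕ.≤-Reasoning
    rearrange : ∀ a b c d → a * b * (c * d) ≡ a * c * (b * d)
    rearrange = solve-∀

  polynomial-≗ : ∀ {f g} → g ≗ f → Polynomial f → Polynomial g
  polynomial-≗ eq (c , d , p) = c , d , λ n → subst (_≤ c * suc n ^ d) (sym (eq n)) (p n)

  infixr 6 _⊹_

  _⊹_ : ∀ k {f} → Polynomial f → Polynomial (λ n → k + f n)
  k ⊹ p = polynomial-+ (polynomial-const k) p

  polynomial-foldTime : ∀ {f g} → Polynomial f → Polynomial g → Polynomial (λ n → foldTime (f n) (g n))
  polynomial-foldTime {f} {g} p q = polynomial-≗ (λ n → closed (f n) (g n))
    (polynomial-+ (polynomial-* p (30 ⊹ q)) (polynomial-const 6))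
    where
    closed : ∀ k t → foldTime k t ≡ k * (30 + t) + 6
    closed zero    t = refl
    closed (suc k) t = trans (cong (_+_ (30 + t)) (closed k t)) (sym (ℕ.+-assoc (30 + t) (k * (30 + t)) 6))

  polynomial-divideTime : ∀ c {f} → Polynomial f → Polynomial (λ n → divideTime c (f n))
  polynomial-divideTime c {f} p = 4 ⊹ polynomial-+
    (polynomial-≗ (λ n → closed (f n)) (polynomial-+ (polynomial-* p (polynomial-const body)) (polynomial-const 3)))
    (polynomial-const 3)
    where
    body : ℕ
    body = 3 + suc (cost (cons (tails (suc c) h₀) (cons nil t₁)))
    closed : ∀ k → divideLoopTime c k ≡ k * body + 3
    closed zero    = refl
    closed (suc k) = trans (cong (_+_ body) (closed k)) (sym (ℕ.+-assoc body (k * body) 3))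

  polynomial-evaluateTime : Polynomial evaluateTime
  polynomial-evaluateTime = 13 ⊹ polynomial-+
    (polynomial-foldTime polynomial-id (polynomial-+ (30 ⊹ polynomial-foldTime polynomial-id (polynomial-const 50)) (polynomial-const 17)))
    (polynomial-const 4)

  polynomial-minimumTime : ∀ {f} → Polynomial f → Polynomial (λ n → minimumTime (f n))
  polynomial-minimumTime p = 8 ⊹ polynomial-+ (polynomial-foldTime p (polynomial-const 20)) (polynomial-const 3)

  polynomial-mainTime : ∀ B → Polynomial (mainTime B)
  polynomial-mainTime B = polynomial-+ (16 ⊹ polynomial-evaluateTime) (7 ⊹ suc (cost (tails B t₁)) ⊹
    polynomial-+ formula-polynomial (3 ⊹ brute-polynomial))
    where
    square : Polynomial (λ n → n * n)
    square = polynomial-* polynomial-id polynomial-id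
    formula-polynomial : Polynomial (λ n → formulaTime n (n * n))
    formula-polynomial = polynomial-+
      (27 ⊹ polynomial-foldTime polynomial-id
        (polynomial-+ (21 ⊹ polynomial-evaluateTime) (polynomial-+ (22 ⊹ polynomial-minimumTime square) (polynomial-const 18))))
      (polynomial-+ (17 ⊹ polynomial-divideTime 1 square)
        (polynomial-+ (17 ⊹ polynomial-divideTime 15 square) (7 ⊹ polynomial-minimumTime square)))
    best-polynomial : Polynomial (λ n → bestTime n (n * n))
    best-polynomial = polynomial-+ (19 ⊹ polynomial-evaluateTime)
      (polynomial-+ (15 ⊹ polynomial-minimumTime square)
        (polynomial-+ (21 ⊹ 9 ⊹ polynomial-+ (polynomial-foldTime square (polynomial-const 20)) (polynomial-const 3)) (polynomial-const 10)))
    brute-polynomial : Polynomial (λ n → bruteTime n (n * n) (2 ^ B))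
    brute-polynomial = polynomial-+
      (16 ⊹ polynomial-foldTime polynomial-id (polynomial-+ (17 ⊹ polynomial-foldTime polynomial-id (polynomial-const 10)) (polynomial-const 7)))
      (polynomial-+ (19 ⊹ polynomial-foldTime (polynomial-+ polynomial-id (polynomial-const 0))
                            (8 ⊹ polynomial-foldTime (polynomial-const (2 ^ B)) (polynomial-const 20)))
        (9 ⊹ polynomial-+ (polynomial-foldTime (polynomial-const (2 ^ B)) best-polynomial)
                          (3 ⊹ polynomial-divideTime 1 square)))

  order<size : ∀ G → suc (Graph.order G) ≤ size (encode G)
  order<size G = subst (λ x → suc (Graph.order G) ≤ size x) (sym (encode≡matrix G)) (size-list _)

  -- Since `ε` is positive, ratio 4 suffices; over the denominator 1 this is the inequality of
  -- natural numbers.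
  ratio : ∀ {ε} → 0ℚ ℚ.< ε → ∀ n k → n ≤ 4 * k → ℕ→ℚ n ℚ.≤ (ℕ→ℚ 4 ℚ.+ ε) ℚ.* ℕ→ℚ k
  ratio {ε} 0<ε n k n≤4k = ℚ.≤-trans
    (ℚ.toℚᵘ-cancel-≤ (begin
      ℚ.toℚᵘ (ℕ→ℚ n)                              ≃⟨ ℚ.toℚᵘ-fromℚᵘ (mkℚᵘ (+ n) 0) ⟩
      mkℚᵘ (+ n) 0                                ≤⟨ *≤* (subst₂ ℤ._≤_ (sym (ℤ.*-identityʳ (+ n))) (sym (trans (ℤ.*-identityʳ _) (sym (ℤ.pos-* 4 k)))) (+≤+ n≤4k)) ⟩
      mkℚᵘ (+ 4) 0 ℚᵘ.* mkℚᵘ (+ k) 0              ≃⟨ ℚᵘ.*-cong (ℚ.toℚᵘ-fromℚᵘ (mkℚᵘ (+ 4) 0)) (ℚ.toℚᵘ-fromℚᵘ (mkℚᵘ (+ k) 0)) ⟨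
      ℚ.toℚᵘ (ℕ→ℚ 4) ℚᵘ.* ℚ.toℚᵘ (ℕ→ℚ k)          ≃⟨ ℚ.toℚᵘ-homo-* (ℕ→ℚ 4) (ℕ→ℚ k) ⟨
      ℚ.toℚᵘ (ℕ→ℚ 4 ℚ.* ℕ→ℚ k)                    ∎))
    (ℚ.*-monoʳ-≤-nonNeg (ℕ→ℚ k) ⦃ ℚ.normalize-nonNeg k 1 ⦄
      (subst (ℚ._≤ ℕ→ℚ 4 ℚ.+ ε) (ℚ.+-identityʳ (ℕ→ℚ 4)) (ℚ.+-monoʳ-≤ (ℕ→ℚ 4) (ℚ.<⇒≤ 0<ε))))
    where open ℚᵘ.≤-Reasoning

  main-approximates : ∀ κ → κ ≡ + 64 → ∀ B → + 32 ℤ.* (κ ℤ.* κ) ≡ + B →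
    ∀ ε → 0ℚ ℚ.< ε → IsApproximationAlgorithm (ℕ→ℚ 4 ℚ.+ ε) (program (main B))
  main-approximates κ κ≡64 B B≡ ε 0<ε = polynomialTime (polynomial-mainTime B) , approximates
    where
    polynomialTime : Polynomial (mainTime B) → PolynomialTime (program (main B))
    polynomialTime (c , d , bound) = c , d , λ G →
      let k , r , _ = main-correct κ κ≡64 B B≡ G
          -- The stack register starts as `nil`.
          t , t≤ , p = r nil
      in unary k , t , (_ , p , refl) ,
         ℕ.≤-trans t≤ (ℕ.≤-trans (bound (Graph.order G))
           (ℕ.≤-trans (ℕ.*-monoʳ-≤ c (ℕ.^-monoˡ-≤ d (order<size G))) (ℕ.m≤m+n _ c)))
    approximates : ∀ G → ∃[ k ] Outputs (program (main B)) G k × G ∈[2, k ]-LCP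
      × ℕ→ℚ (k-opt G) ℚ.≤ (ℕ→ℚ 4 ℚ.+ ε) ℚ.* ℕ→ℚ k
    approximates G =
      let k , r , lcp , bound = main-correct κ κ≡64 B B≡ G
          t , _ , p = r nil
      in k , (t , _ , p , refl) , lcp , ratio 0<ε (k-opt G) k bound

open Approximation using (main-approximates)
open Machine using (main)
open import Data.Integer.Base using (+_)
open import Data.Rational.Base using (ℚ; 0ℚ; _<_; _+_)

-- 131072 = 32 · 64² bounds twice the number of edges of a small graph.
theorem5 : ∀ (ε : ℚ) → 0ℚ < ε → ∃[ P ] IsApproximationAlgorithm (ℕ→ℚ 4 + ε) P
theorem5 ε 0<ε = program (main 131072) , main-approximates (+ 64) refl 131072 refl ε 0<ε
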